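{- For every $d\geq 3$, the homomorphism order of line graphs is universal on the interval $[K_d,K_{d+1})_{\mathcal{L}}$.
   Context: The line graph $L(G)$ of a finite undirected simple graph $G$ is the graph whose vertices are the edges of $G$, two of them adjacent iff they are distinct and share a common endpoint in $G$. For graphs, $A\leq B$ means that there is a graph homomorphism from $A$ to $B$, and $A<B$ means $A\leq B$ and not $B\leq A$; this quasi-order is regarded as a partial order by identifying homomorphically equivalent graphs. $K_n$ is the complete graph on $n$ vertices. $[K_d,K_{d+1})_{\mathcal{L}}$ is the class of all line graphs $L(G)$ of finite graphs $G$ with $K_d\leq L(G)<K_{d+1}$, ordered by $\leq$. A countable partial order is universal if every countable partial order $(P,\leq_P)$ embeds into it, i.e. there is a map $E$ with $a\leq_P b\iff E(a)\leq E(b)$ for all $a,b\in P$. -}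

module Defs where

open import Data.Bool.Base using (Bool; false; T)
open import Data.Fin.Base using (Fin; _<_)
open import Data.Nat.Base using (ℕ; suc)
open import Data.Product.Base using (_×_; _,_; ∃; ∃-syntax)
open import Data.Sum.Base using (_⊎_)
open import Function.Base using (id; _∘_)
open import Function.Bundles using (Injection; _⇔_)
open import Level using (Level; 0ℓ) renaming (suc to lsuc; _⊔_ to _⊔ˡ_)
open import Relation.Binary.Bundles using (Poset)
open import Relation.Binary.Core using (Rel)
open import Relation.Binary.Definitions using (Reflexive; Transitive; Symmetric; Irreflexive)
open import Relation.Binary.PropositionalEquality.Core using (_≡_; _≢_; refl; sym; ≢-sym)
open import Relation.Binary.PropositionalEquality.Properties using (setoid)
open import Relation.Nullary.Negation.Core using (¬_)
import Relation.Binary.Construct.Interior.Symmetric as SymInterior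
import Relation.Binary.Construct.On as On

record Graph : Set₁ where
  field
    Vertex     : Set
    Adj        : Rel Vertex 0ℓ
    Adj-sym    : Symmetric Adj
    Adj-irrefl : Irreflexive _≡_ Adj

open Graph public

infix 4 _≤ᴴ_ _<ᴴ_

record _≤ᴴ_ (A B : Graph) : Set where
  field
    map      : Vertex A → Vertex B
    map-pres : ∀ {u v} → Adj A u v → Adj B (map u) (map v)

_<ᴴ_ : Rel Graph 0ℓ
A <ᴴ B = A ≤ᴴ B × ¬ (B ≤ᴴ A)

≤ᴴ-refl : Reflexive _≤ᴴ_
≤ᴴ-refl = record { map = id ; map-pres = id }

≤ᴴ-trans : Transitive _≤ᴴ_
≤ᴴ-trans f g = record
  { map      = _≤ᴴ_.map g ∘ _≤ᴴ_.map f
  ; map-pres = _≤ᴴ_.map-pres g ∘ _≤ᴴ_.map-pres f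
  }

-- The homomorphism order, with homomorphic equivalence as its equality.
homomorphismOrder : Poset _ _ _
homomorphismOrder = SymInterior.poset {R = _≤ᴴ_} ≤ᴴ-refl ≤ᴴ-trans

K : ℕ → Graph
K n = record
  { Vertex     = Fin n
  ; Adj        = _≢_
  ; Adj-sym    = ≢-sym
  ; Adj-irrefl = λ i≡j i≢j → i≢j i≡j
  }

record FiniteGraph : Set where
  field
    order      : ℕ
    adj        : Fin order → Fin order → Bool
    adj-sym    : ∀ i j → adj i j ≡ adj j i
    adj-irrefl : ∀ i → adj i i ≡ false

-- The edge {lo , hi} is listed once, with its smaller endpoint first, so that
-- propositional equality of edges is equality of unordered pairs.
record Edge (G : FiniteGraph) : Set where
  open FiniteGraph G
  field
    lo hi    : Fin order
    lo<hi    : lo < hi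
    adjacent : T (adj lo hi)

module _ {G : FiniteGraph} where
  open FiniteGraph G

  IsEndpoint : Fin order → Edge G → Set
  IsEndpoint v e = v ≡ Edge.lo e ⊎ v ≡ Edge.hi e

  ShareEndpoint : Rel (Edge G) 0ℓ
  ShareEndpoint e f = ∃[ v ] (IsEndpoint v e × IsEndpoint v f)

L : FiniteGraph → Graph
L G = record
  { Vertex     = Edge G
  ; Adj        = λ e f → e ≢ f × ShareEndpoint e f
  ; Adj-sym    = λ (e≢f , v , v∈e , v∈f) → ≢-sym e≢f , v , v∈f , v∈e
  ; Adj-irrefl = λ e≡f (e≢f , _) → e≢f e≡f
  }

record LineGraphBetween (d : ℕ) : Set where
  field
    root  : FiniteGraph
    lower : K d ≤ᴴ L root
    upper : L root <ᴴ K (suc d)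

  lineGraph : Graph
  lineGraph = L root

-- [K d , K (1 + d)) among line graphs.
interval : ℕ → Poset 0ℓ 0ℓ 0ℓ
interval d = On.poset homomorphismOrder (LineGraphBetween.lineGraph {d})

Countable : ∀ {c ℓ₁ ℓ₂} → Poset c ℓ₁ ℓ₂ → Set (c ⊔ˡ ℓ₁)
Countable P = Injection (Poset.Eq.setoid P) (setoid ℕ)

Embeds : ∀ {c ℓ₁ ℓ₂ c′ ℓ₁′ ℓ₂′} → Poset c ℓ₁ ℓ₂ → Poset c′ ℓ₁′ ℓ₂′ → Set (c ⊔ˡ ℓ₂ ⊔ˡ c′ ⊔ˡ ℓ₂′)
Embeds P Q = ∃ λ (E : P.Carrier → Q.Carrier) → ∀ a b → (a P.≤ b) ⇔ (E a Q.≤ E b)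
  where
  module P = Poset P
  module Q = Poset Q

-- Universality is a property of countable orders, so it includes countability.
-- The levels c, ℓ₁, ℓ₂ are those of the orders to be embedded.
Universal : ∀ (c ℓ₁ ℓ₂ : Level) {c′ ℓ₁′ ℓ₂′} → Poset c′ ℓ₁′ ℓ₂′ →
            Set (lsuc (c ⊔ˡ ℓ₁ ⊔ˡ ℓ₂) ⊔ˡ c′ ⊔ˡ ℓ₁′ ⊔ˡ ℓ₂′)
Universal c ℓ₁ ℓ₂ Q = Countable Q × (∀ (P : Poset c ℓ₁ ℓ₂) → Countable P → Embeds P Q)

{-# OPTIONS --safe #-}

-- Subdividing one edge of K_{d,d} by a new vertex gives a graph that is not d-edge-colourable, and it is rigid:
-- suppose a weight on the edges of H has the same sum over every d-clique of L(H). Under a homomorphism into L(H)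
-- the d-cliques at the two sides of K_{d,d} give row sums and column sums of a square array which agree, so the two
-- halves of the subdivided edge receive equal weight. If the only adjacent edges of H of equal weight are the two
-- halves of such subdivided edges, halves go to halves and a pendant edge attached to the subdividing vertex goes to
-- such a pendant edge. Decorating the vertices of a cycle alternately with one and with two of these graphs forbids
-- folding, so the decorated cycles admit homomorphisms exactly according to divisibility of their lengths.
--
-- For a preorder R on ℕ, let N k be the product of the eᵢ with i ≤ k and R k i, for a pairwise coprime sequence e.
-- Then N k divides N j whenever k ≤ j and R j k, and N k ∣ N j implies R j k. The element k is represented by the
-- disjoint union of the decorated cycles of lengths N j over all j ≤ k with R j k: if R m n, then for j in the family
-- of m either j itself (if j ≤ n) or n provides a cycle to which the j-th one maps.

module Submission where

open import Defs
open import Axiom.ExcludedMiddle using (ExcludedMiddle)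
open import Data.Bool.Base using (Bool; true; false; T; if_then_else_)
open import Data.Bool.Properties using (T-irrelevant)
open import Data.Empty using (⊥)
open import Data.Fin.Base as Fin using (Fin; zero; suc; toℕ; fromℕ; fromℕ<; inject₁; inject≤; combine; remQuot; punchOut)
open import Data.Fin.Patterns
open import Data.Fin.Permutation using (permutation)
open import Data.Fin.Properties as Fin
  using ( any?; all?; toℕ<n; toℕ-fromℕ<; toℕ-injective; inject₁-injective; fromℕ≢inject₁; combine-injective
        ; remQuot-combine; injective⇒≤; punchOut-injective )
open import Data.List.Base using (List; []; _∷_; tabulate)
open import Data.List.Properties using (∷-injective)
open import Data.Nat.Base hiding (_⊔_)
open import Data.Nat.Coprimality using (Coprime; coprime-divisor) renaming (sym to coprime-sym)
open import Data.Nat.Divisibility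
open import Data.Nat.DivMod
open import Data.Nat.GeneralisedArithmetic using (fold)
open import Data.Nat.Induction using (<-rec)
open import Data.Nat.Properties
import Data.Product.Base as Product
open import Data.Product.Base using (Σ; _×_; _,_; proj₁; proj₂; ∃; ∃-syntax; uncurry)
open import Data.Sum.Base using (_⊎_; inj₁; inj₂; [_,_]′; swap)
open import Function.Base using (_∘_; id; case_of_)
open import Function.Bundles using (Equivalence; Injection; mk⇔; _⇔_)
open import Function.Definitions using (Injective)
open import Level using (Level; 0ℓ; Lift; lift; lower; _⊔_)
open import Relation.Binary.Bundles using (Poset)
open import Relation.Binary.Core using (Rel)
import Relation.Binary.Definitions as Binary
open import Relation.Binary.Definitions using (Reflexive; Transitive; tri<; tri≈; tri>)
open import Relation.Binary.PropositionalEquality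
open import Relation.Nullary.Decidable using (Dec; yes; no; does; does-⇔; dec-false; from-yes; map′; _×-dec_; _⊎-dec_; ¬?)
open import Relation.Nullary.Negation.Core using (¬_; contradiction)
open import Relation.Unary using (Pred; Decidable)
open import Algebra.Properties.CommutativeMonoid.Sum +-0-commutativeMonoid using (sum; sum-cong-≗; sum-permute; ∑-comm)

private variable
  ℓ ℓ′ : Level

-- Residues

%-cancelˡ : ∀ c {a b n} .{{_ : NonZero n}} → (c + a) % n ≡ (c + b) % n → a % n ≡ b % n
%-cancelˡ c {a} {b} {n} eq = trans (sym (undo a)) (trans (cong (λ r → (c * n ∸ c + r) % n) eq) (undo b))
  where
  open ≡-Reasoning
  c≤cn : c ≤ c * n
  c≤cn = m≤m*n c n
  -- Since `n` is positive, `c * n ∸ c` is an additive inverse of `c` modulo `n`.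
  undo : ∀ r → (c * n ∸ c + (c + r) % n) % n ≡ r % n
  undo r = begin
    (c * n ∸ c + (c + r) % n) % n           ≡⟨ %-distribˡ-+ (c * n ∸ c) ((c + r) % n) n ⟩
    ((c * n ∸ c) % n + (c + r) % n % n) % n ≡⟨ cong (λ t → ((c * n ∸ c) % n + t) % n) (m%n%n≡m%n (c + r) n) ⟩
    ((c * n ∸ c) % n + (c + r) % n) % n     ≡⟨ %-distribˡ-+ (c * n ∸ c) (c + r) n ⟨
    (c * n ∸ c + (c + r)) % n               ≡⟨ cong (_% n) (+-assoc (c * n ∸ c) c r) ⟨
    (c * n ∸ c + c + r) % n                 ≡⟨ cong (λ t → (t + r) % n) (m∸n+n≡m c≤cn) ⟩
    (c * n + r) % n                         ≡⟨ %-remove-+ˡ r (n∣m*n c) ⟩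
    r % n                                   ∎

+-%-injective : ∀ c {n} .{{_ : NonZero n}} {i j : Fin n} → (c + toℕ i) % n ≡ (c + toℕ j) % n → i ≡ j
+-%-injective c {n} {i} {j} eq = toℕ-injective (begin
  toℕ i     ≡⟨ m<n⇒m%n≡m (toℕ<n i) ⟨
  toℕ i % n ≡⟨ %-cancelˡ c eq ⟩
  toℕ j % n ≡⟨ m<n⇒m%n≡m (toℕ<n j) ⟩
  toℕ j     ∎)
  where open ≡-Reasoning

+-%-%ʳ : ∀ a b n .{{_ : NonZero n}} → (a + b % n) % n ≡ (a + b) % n
+-%-%ʳ a b n = begin
  (a + b % n) % n         ≡⟨ %-distribˡ-+ a (b % n) n ⟩
  (a % n + b % n % n) % n ≡⟨ cong (λ t → (a % n + t) % n) (m%n%n≡m%n b n) ⟩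
  (a % n + b % n) % n     ≡⟨ %-distribˡ-+ a b n ⟨
  (a + b) % n             ∎
  where open ≡-Reasoning

-- Pairwise coprime numbers

-- The numbers `euclid k` form Sylvester's sequence 2, 3, 7, 43, ...: each is one more than the
-- product `euclidProduct k` of all earlier ones.
euclidProduct : ℕ → ℕ
euclidProduct zero    = 1
euclidProduct (suc k) = suc (euclidProduct k) * euclidProduct k

euclid : ℕ → ℕ
euclid k = suc (euclidProduct k)

euclidProduct≥1 : ∀ k → 1 ≤ euclidProduct k
euclidProduct≥1 zero    = ≤-refl
euclidProduct≥1 (suc k) = ≤-trans (euclidProduct≥1 k) (m≤n*m (euclidProduct k) (euclid k))

euclid∣euclidProduct : ∀ {i k} → i < k → euclid i ∣ euclidProduct k
euclid∣euclidProduct {i} {suc k} (s≤s i≤k) with m≤n⇒m<n∨m≡n i≤k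
... | inj₁ i<k  = ∣n⇒∣m*n (euclid k) (euclid∣euclidProduct i<k)
... | inj₂ refl = m∣m*n (euclidProduct k)

-- A common divisor divides both `euclidProduct k` and its successor.
<⇒coprime : ∀ {i k} → i < k → Coprime (euclid i) (euclid k)
<⇒coprime {k = k} i<k {d} (d∣eᵢ , d∣eₖ) =
  ∣1⇒≡1 (∣m+n∣m⇒∣n (subst (d ∣_) (+-comm 1 (euclidProduct k)) d∣eₖ) (∣-trans d∣eᵢ (euclid∣euclidProduct i<k)))

≢⇒coprime : ∀ {i k} → i ≢ k → Coprime (euclid i) (euclid k)
≢⇒coprime {i} {k} i≢k with <-cmp i k
... | tri< i<k _ _ = <⇒coprime i<k
... | tri≈ _ i≡k _ = contradiction i≡k i≢k
... | tri> _ _ k<i = coprime-sym (<⇒coprime k<i)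

module _ {P : Pred ℕ ℓ} (P? : Decidable P) where

  euclidFactor : ℕ → ℕ
  euclidFactor n = if does (P? n) then euclid n else 1

  euclidProductOver : ℕ → ℕ
  euclidProductOver zero    = 1
  euclidProductOver (suc n) = euclidFactor n * euclidProductOver n

  euclidProductOver≥1 : ∀ n → 1 ≤ euclidProductOver n
  euclidProductOver≥1 zero    = ≤-refl
  euclidProductOver≥1 (suc n) with P? n
  ... | yes _ = ≤-trans (euclidProductOver≥1 n) (m≤n*m _ (euclid n))
  ... | no  _ = ≤-trans (euclidProductOver≥1 n) (m≤n*m _ 1)

  euclid∣euclidProductOver : ∀ {i n} → i < n → P i → euclid i ∣ euclidProductOver n
  euclid∣euclidProductOver {i} {suc n} (s≤s i≤n) Pi with m≤n⇒m<n∨m≡n i≤n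
  ... | inj₁ i<n  = ∣n⇒∣m*n (euclidFactor n) (euclid∣euclidProductOver i<n Pi)
  ... | inj₂ refl with P? n
  ...   | yes _  = m∣m*n (euclidProductOver n)
  ...   | no ¬Pi = contradiction Pi ¬Pi

  -- A factor with another index is coprime to `euclid i` and can be cancelled, so the descent has
  -- to meet the factor `euclid i` itself; it cannot end at the empty product, because `euclid i`
  -- exceeds 1.
  euclid∣euclidProductOver⇒P : ∀ {i} n → euclid i ∣ euclidProductOver n → P i
  euclid∣euclidProductOver⇒P {i} zero e∣1 =
    contradiction (euclidProduct≥1 i) (subst (λ t → ¬ 1 ≤ t) (sym (suc-injective (∣1⇒≡1 e∣1))) λ ())
  euclid∣euclidProductOver⇒P {i} (suc n) e∣ with P? n | i ≟ n
  ... | no _   | _        = euclid∣euclidProductOver⇒P n (subst (euclid i ∣_) (+-identityʳ _) e∣)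
  ... | yes Pi | yes refl = Pi
  ... | yes _  | no i≢n   = euclid∣euclidProductOver⇒P n (coprime-divisor (≢⇒coprime i≢n) e∣)

euclidProductOver-∣ : {P : Pred ℕ ℓ} (P? : Decidable P) {Q : Pred ℕ ℓ′} (Q? : Decidable Q) →
                      (∀ {i} → P i → Q i) → ∀ {m n} → m ≤ n →
                      euclidProductOver P? m ∣ euclidProductOver Q? n
euclidProductOver-∣ P? Q? P⊆Q {m} {zero}  z≤n = ∣-refl
euclidProductOver-∣ P? Q? P⊆Q {m} {suc n} m≤1+n with m≤n⇒m<n∨m≡n m≤1+n
... | inj₁ (s≤s m≤n) = ∣n⇒∣m*n (euclidFactor Q? n) (euclidProductOver-∣ P? Q? P⊆Q m≤n)
... | inj₂ refl      = *-pres-∣ factor (euclidProductOver-∣ P? Q? P⊆Q (≤-refl {n}))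
  where
  factor : euclidFactor P? n ∣ euclidFactor Q? n
  factor with P? n | Q? n
  ... | yes _ | yes _ = ∣-refl
  ... | yes p | no ¬q = contradiction (P⊆Q p) ¬q
  ... | no _  | _     = 1∣ _

-- Sums over finite sets

-- Punching out a missed value would leave an injection into a smaller finite set.
injective⇒surjective : ∀ {n} {f : Fin n → Fin n} → Injective _≡_ _≡_ f → ∀ i → ∃[ j ] f j ≡ i
injective⇒surjective {suc n} {f} f-inj i with any? (λ j → f j Fin.≟ i)
... | yes found = found
... | no ¬found =
  contradiction (injective⇒≤ {f = λ j → punchOut (i≢f j)} (f-inj ∘ punchOut-injective (i≢f _) (i≢f _))) 1+n≰n
  where
  i≢f : ∀ j → i ≢ f j
  i≢f j i≡fj = ¬found (j , sym i≡fj)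

-- An injection between sets of equal size permutes the summands. The sizes are two variables
-- because the degree of a vertex equals `d` only by a proof.
sum-injective : ∀ {m n} (h : Fin n → ℕ) {f : Fin m → Fin n} → Injective _≡_ _≡_ f → m ≡ n → sum (h ∘ f) ≡ sum h
sum-injective h {f} f-inj refl = sym (sum-permute h
  (permutation f (proj₁ ∘ f-surj) (proj₂ ∘ f-surj) (λ i → f-inj (proj₂ (f-surj (f i))))))
  where f-surj = injective⇒surjective f-inj

≤sum : ∀ {n} (h : Fin n → ℕ) i → h i ≤ sum h
≤sum h zero    = m≤m+n _ _
≤sum h (suc i) = ≤-trans (≤sum (h ∘ suc) i) (m≤n+m _ (h zero))

sum-const : ∀ {n} (h h′ : Fin n → ℕ) {c} → (∀ i → h i ≡ c) → (∀ i → h′ i ≡ c) → sum h ≡ sum h′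
sum-const h h′ h≡c h′≡c = sum-cong-≗ λ i → trans (h≡c i) (sym (h′≡c i))

-- Both arrays have the same total, summed by rows and by columns respectively.
corner-≡ : ∀ {n c} (h h′ : Fin (suc n) → Fin (suc n) → ℕ) →
           (∀ i j → h i (suc j) ≡ h′ i (suc j)) → (∀ i → h (suc i) zero ≡ h′ (suc i) zero) →
           (∀ i → sum (h i) ≡ c) → (∀ j → sum (λ i → h′ i j) ≡ c) →
           h zero zero ≡ h′ zero zero
corner-≡ {n} {c} h h′ agree agree₀ rows columns =
  +-cancelʳ-≡ _ _ _ (+-cancelʳ-≡ (sum (sum ∘ h ∘ suc)) _ _ (begin
    sum (sum ∘ h)                                           ≡⟨ sum-const (sum ∘ h) _ rows columns ⟩
    sum (λ j → sum (λ i → h′ i j))                          ≡⟨ ∑-comm (λ i j → h′ i j) ⟨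
    sum (sum ∘ h′)                                          ≡⟨ cong₂ _+_ first-row later-rows ⟩
    h′ zero zero + sum (h zero ∘ suc) + sum (sum ∘ h ∘ suc) ∎))
  where
  open ≡-Reasoning
  first-row : sum (h′ zero) ≡ h′ zero zero + sum (h zero ∘ suc)
  first-row = cong (h′ zero zero +_) (sum-cong-≗ (sym ∘ agree zero))
  later-rows : sum (sum ∘ h′ ∘ suc) ≡ sum (sum ∘ h ∘ suc)
  later-rows = sum-cong-≗ λ i → cong₂ _+_ (sym (agree₀ i)) (sum-cong-≗ (sym ∘ agree (suc i)))

-- Finite permutations

-- Since the carrier is finite, a left inverse of next is all that is needed.
record FinitePermutation : Set₁ where
  field
    Carrier         : Set
    next prev       : Carrier → Carrier
    prev-next       : ∀ x → prev (next x) ≡ x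
    next-≢          : ∀ x → x ≢ next x
    size            : ℕ
    index           : Carrier → Fin size
    index-injective : Injective _≡_ _≡_ index

  next-injective : Injective _≡_ _≡_ next
  next-injective {x} {y} eq = trans (sym (prev-next x)) (trans (cong prev eq) (prev-next y))

  next^ : ℕ → Carrier → Carrier
  next^ n x = fold x next n

  next^-next : ∀ n x → next^ n (next x) ≡ next (next^ n x)
  next^-next zero    x = refl
  next^-next (suc n) x = cong next (next^-next n x)

rotateBy : ∀ {n} .{{_ : NonZero n}} → ℕ → Fin n → Fin n
rotateBy {n} k r = (k + toℕ r) mod n

toℕ-mod : ∀ k n .{{_ : NonZero n}} → toℕ (k mod n) ≡ k % n
toℕ-mod k n = toℕ-fromℕ< (m%n<n k n)

module _ {n} .{{_ : NonZero n}} where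

  mod-cong : ∀ {a b} → a % n ≡ b % n → a mod n ≡ b mod n
  mod-cong {a} {b} eq = toℕ-injective (trans (toℕ-mod a n) (trans eq (sym (toℕ-mod b n))))

  rotateBy-+ : ∀ a b (r : Fin n) → rotateBy a (rotateBy b r) ≡ rotateBy (a + b) r
  rotateBy-+ a b r = mod-cong (begin
    (a + toℕ ((b + toℕ r) mod n)) % n ≡⟨ cong (λ t → (a + t) % n) (toℕ-mod (b + toℕ r) n) ⟩
    (a + (b + toℕ r) % n) % n         ≡⟨ +-%-%ʳ a (b + toℕ r) n ⟩
    (a + (b + toℕ r)) % n             ≡⟨ cong (_% n) (+-assoc a b (toℕ r)) ⟨
    (a + b + toℕ r) % n               ∎)
    where open ≡-Reasoning

  rotateBy-∣ : ∀ {k} → n ∣ k → (r : Fin n) → rotateBy k r ≡ r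
  rotateBy-∣ {k} n∣k r = toℕ-injective (begin
    toℕ ((k + toℕ r) mod n) ≡⟨ toℕ-mod (k + toℕ r) n ⟩
    (k + toℕ r) % n         ≡⟨ %-remove-+ˡ (toℕ r) n∣k ⟩
    toℕ r % n               ≡⟨ m<n⇒m%n≡m (toℕ<n r) ⟩
    toℕ r                   ∎)
    where open ≡-Reasoning

  rotateBy-fixed⇒∣ : ∀ k (r : Fin n) → rotateBy k r ≡ r → n ∣ k
  rotateBy-fixed⇒∣ k r eq = m%n≡0⇒n∣m k n (trans (%-cancelˡ (toℕ r) (begin
    (toℕ r + k) % n         ≡⟨ cong (_% n) (+-comm (toℕ r) k) ⟩
    (k + toℕ r) % n         ≡⟨ toℕ-mod (k + toℕ r) n ⟨
    toℕ ((k + toℕ r) mod n) ≡⟨ cong toℕ eq ⟩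
    toℕ r                   ≡⟨ m<n⇒m%n≡m (toℕ<n r) ⟨
    toℕ r % n               ≡⟨ cong (_% n) (+-identityʳ (toℕ r)) ⟨
    (toℕ r + 0) % n         ∎)) (m<n⇒m%n≡m (>-nonZero⁻¹ n)))
    where open ≡-Reasoning

-- This makes reduction modulo `m` a covering of the cycle of length `m` by the cycle of length `n`.
rotateBy-mod : ∀ {m n} .{{_ : NonZero m}} .{{_ : NonZero n}} → m ∣ n → ∀ k (r : Fin n) →
               toℕ (rotateBy k r) mod m ≡ rotateBy k (toℕ r mod m)
rotateBy-mod {m} {n} m∣n k r = mod-cong (begin
  toℕ ((k + toℕ r) mod n) % m     ≡⟨ cong (_% m) (toℕ-mod (k + toℕ r) n) ⟩
  (k + toℕ r) % n % m             ≡⟨ m∣n⇒o%n%m≡o%m m n (k + toℕ r) m∣n ⟩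
  (k + toℕ r) % m                 ≡⟨ +-%-%ʳ k (toℕ r) m ⟨
  (k + toℕ r % m) % m             ≡⟨ cong (λ t → (k + t) % m) (toℕ-mod (toℕ r) m) ⟨
  (k + toℕ (toℕ r mod m)) % m     ∎)
  where open ≡-Reasoning

module Cycles {m} (length : Fin m → ℕ) (length≥2 : ∀ j → 2 ≤ length j) where

  instance
    length-nonZero : ∀ {j} → NonZero (length j)
    length-nonZero {j} = >-nonZero (≤-trans (s≤s z≤n) (length≥2 j))

  rotate : ℕ → Σ (Fin m) (Fin ∘ length) → Σ (Fin m) (Fin ∘ length)
  rotate k (j , r) = j , rotateBy k r

  private
    Σ-injectiveʳ : ∀ {j} {r s : Fin (length j)} → _≡_ {A = Σ (Fin m) (Fin ∘ length)} (j , r) (j , s) → r ≡ s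
    Σ-injectiveʳ refl = refl

  cycles : FinitePermutation
  cycles = record
    { Carrier         = Σ (Fin m) (Fin ∘ length)
    ; next            = rotate 1
    ; prev            = λ (j , r) → rotate (length j ∸ 1) (j , r)
    ; prev-next       = λ (j , r) → cong (j ,_)
        (trans (rotateBy-+ (length j ∸ 1) 1 r) (rotateBy-∣ (∣-reflexive (sym ([n∸1]+1 j))) r))
    ; next-≢          = λ (j , r) eq →
        contradiction (rotateBy-fixed⇒∣ 1 r (sym (Σ-injectiveʳ eq))) (>⇒∤ (length≥2 j))
    -- A crude bound suffices for an injective index: every cycle length is at most the sum of all
    -- of them.
    ; size            = m * sum length
    ; index           = λ (j , r) → combine j (inject≤ r (≤sum length j))
    ; index-injective = index-inj _ _
    }
    where
    [n∸1]+1 : ∀ j → length j ∸ 1 + 1 ≡ length j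
    [n∸1]+1 j = m∸n+n≡m (≤-trans (s≤s z≤n) (length≥2 j))
    index-inj : ∀ x y → combine (proj₁ x) (inject≤ (proj₂ x) (≤sum length (proj₁ x)))
                      ≡ combine (proj₁ y) (inject≤ (proj₂ y) (≤sum length (proj₁ y))) → x ≡ y
    index-inj (j , r) (j′ , r′) eq with refl , eq′ ← combine-injective j _ j′ _ eq =
      cong (j ,_) (Fin.inject≤-injective (≤sum length j) (≤sum length j) r r′ eq′)

  open FinitePermutation cycles using (next^)

  next^-rotate : ∀ k x → next^ k x ≡ rotate k x
  next^-rotate zero    (j , r) = cong (j ,_) (sym (rotateBy-∣ (_ ∣0) r))
  next^-rotate (suc k) (j , r) = trans (cong (rotate 1) (next^-rotate k (j , r))) (cong (j ,_) (rotateBy-+ 1 k r))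

  next^-length : ∀ x → next^ (length (proj₁ x)) x ≡ x
  next^-length x@(j , r) = trans (next^-rotate (length j) x) (cong (j ,_) (rotateBy-∣ ∣-refl r))

  next^-fixed⇒∣ : ∀ k x → next^ k x ≡ x → length (proj₁ x) ∣ k
  next^-fixed⇒∣ k x@(j , r) eq = rotateBy-fixed⇒∣ k r (Σ-injectiveʳ (trans (sym (next^-rotate k x)) eq))

-- Finite graphs

lower-excludedMiddle : ∀ {a} b → ExcludedMiddle (a ⊔ b) → ExcludedMiddle a
lower-excludedMiddle b em {P} = map′ lower lift (em {Lift b P})

module _ {a} {A : Set a} where

  from-does : (a? : Dec A) → T (does a?) → A
  from-does (yes a) _ = a

  to-does : (a? : Dec A) → A → T (does a?)
  to-does (yes _) _ = _
  to-does (no ¬a) a = ¬a a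

-- A finite simple graph presented by its edges, each with a chosen orientation, so that the
-- vertices of its line graph may form any type.
record EdgeSystem : Set₁ where
  field
    Vert Edg        : Set
    src tgt         : Edg → Vert
    src≢tgt         : ∀ e → src e ≢ tgt e
    no-parallel     : ∀ {e f} → src e ≡ src f → tgt e ≡ tgt f → e ≡ f
    no-antiparallel : ∀ {e f} → src e ≡ tgt f → tgt e ≡ src f → ⊥
    order           : ℕ
    index           : Vert → Fin order
    index-injective : Injective _≡_ _≡_ index

  infix 4 _∈_
  _∈_ : Vert → Edg → Set
  v ∈ e = v ≡ src e ⊎ v ≡ tgt e

  lineGraph : Graph
  lineGraph = record
    { Vertex     = Edg
    ; Adj        = λ e f → e ≢ f × ∃[ v ] (v ∈ e × v ∈ f)
    ; Adj-sym    = λ (e≢f , v , v∈e , v∈f) → ≢-sym e≢f , v , v∈f , v∈e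
    ; Adj-irrefl = λ e≡f (e≢f , _) → e≢f e≡f
    }

Edge-≡ : ∀ {G} {x y : Edge G} → Edge.lo x ≡ Edge.lo y → Edge.hi x ≡ Edge.hi y → x ≡ y
Edge-≡ {x = record { lo<hi = p ; adjacent = a }} {record { lo<hi = q ; adjacent = b }} refl refl
  rewrite Fin.<-irrelevant p q | T-irrelevant a b = refl

module _ (S : EdgeSystem) (em : ExcludedMiddle 0ℓ) where
  open EdgeSystem S

  Joins : Edg → Fin order → Fin order → Set
  Joins e i j = (index (src e) ≡ i × index (tgt e) ≡ j) ⊎ (index (tgt e) ≡ i × index (src e) ≡ j)

  Joins-sym : ∀ {e i j} → Joins e i j → Joins e j i
  Joins-sym (inj₁ (p , q)) = inj₂ (q , p)
  Joins-sym (inj₂ (p , q)) = inj₁ (q , p)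

  Joined : Fin order → Fin order → Set
  Joined i j = ∃[ e ] Joins e i j

  Joins-irrefl : ∀ {e i} → ¬ Joins e i i
  Joins-irrefl {e} (inj₁ (p , q)) = src≢tgt e (index-injective (trans p (sym q)))
  Joins-irrefl {e} (inj₂ (p , q)) = src≢tgt e (index-injective (trans q (sym p)))

  Joins-unique : ∀ {e f i j} → Joins e i j → Joins f i j → e ≡ f
  Joins-unique (inj₁ (refl , refl)) (inj₁ (p , q)) = sym (no-parallel (index-injective p) (index-injective q))
  Joins-unique (inj₁ (refl , refl)) (inj₂ (p , q)) =
    contradiction (index-injective p) λ t → no-antiparallel (sym t) (sym (index-injective q))
  Joins-unique (inj₂ (refl , refl)) (inj₁ (p , q)) =
    contradiction (index-injective p) λ t → no-antiparallel t (index-injective q)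
  Joins-unique (inj₂ (refl , refl)) (inj₂ (p , q)) = sym (no-parallel (index-injective q) (index-injective p))

  -- Indices outside the image of `index` become isolated vertices and leave the line graph
  -- unchanged. Excluded middle decides adjacency, as the edges come without an enumeration.
  finiteGraph : FiniteGraph
  finiteGraph = record
    { order      = order
    ; adj        = λ i j → does (em {Joined i j})
    ; adj-sym    = λ i j → does-⇔ (mk⇔ (λ (e , J) → e , Joins-sym J) (λ (e , J) → e , Joins-sym J)) em em
    ; adj-irrefl = λ i → dec-false em (λ (_ , J) → Joins-irrefl J)
    }

  private
    Matches : Edge finiteGraph → Edg → Set
    Matches x e = Joins e (Edge.lo x) (Edge.hi x)

    matching : ∀ x → ∃ (Matches x)
    matching x = from-does em (Edge.adjacent x)

    matching⁻¹ : ∀ e → ∃ λ x → Matches x e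
    -- An `Edge` starts at its smaller index, which may be the source or the target of `e`; `Joins`
    -- therefore admits both orientations.
    matching⁻¹ e with Fin.<-cmp (index (src e)) (index (tgt e))
    ... | tri< lt _ _ = record { lo<hi = lt ; adjacent = to-does em (e , inj₁ (refl , refl)) } , inj₁ (refl , refl)
    ... | tri≈ _ eq _ = contradiction (index-injective eq) (src≢tgt e)
    ... | tri> _ _ gt = record { lo<hi = gt ; adjacent = to-does em (e , inj₂ (refl , refl)) } , inj₂ (refl , refl)

    Matches-unique : ∀ {x y e} → Matches x e → Matches y e → x ≡ y
    Matches-unique {x} {y} (inj₁ (refl , refl)) (inj₁ (refl , refl)) = Edge-≡ refl refl
    Matches-unique {x} {y} (inj₁ (p , q)) (inj₂ (p′ , q′)) =
      contradiction (Edge.lo<hi y) (Fin.<-asym (subst₂ Fin._<_ (trans (sym p) q′) (trans (sym q) p′) (Edge.lo<hi x)))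
    Matches-unique {x} {y} (inj₂ (p , q)) (inj₁ (p′ , q′)) =
      contradiction (Edge.lo<hi y) (Fin.<-asym (subst₂ Fin._<_ (trans (sym p) q′) (trans (sym q) p′) (Edge.lo<hi x)))
    Matches-unique {x} {y} (inj₂ (refl , refl)) (inj₂ (refl , refl)) = Edge-≡ refl refl

    endpoint : ∀ {x e} → Matches x e → ∀ {i} → IsEndpoint {finiteGraph} i x → ∃[ v ] index v ≡ i × v ∈ e
    endpoint {e = e} (inj₁ (p , q)) (inj₁ refl) = src e , p , inj₁ refl
    endpoint {e = e} (inj₁ (p , q)) (inj₂ refl) = tgt e , q , inj₂ refl
    endpoint {e = e} (inj₂ (p , q)) (inj₁ refl) = tgt e , p , inj₂ refl
    endpoint {e = e} (inj₂ (p , q)) (inj₂ refl) = src e , q , inj₁ refl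

    endpoint⁻¹ : ∀ {x e} → Matches x e → ∀ {v} → v ∈ e → IsEndpoint {finiteGraph} (index v) x
    endpoint⁻¹ (inj₁ (p , q)) (inj₁ refl) = inj₁ p
    endpoint⁻¹ (inj₁ (p , q)) (inj₂ refl) = inj₂ q
    endpoint⁻¹ (inj₂ (p , q)) (inj₁ refl) = inj₂ q
    endpoint⁻¹ (inj₂ (p , q)) (inj₂ refl) = inj₁ p

  -- Distinct edges stay distinct because an edge of the system matches at most one listed edge; a
  -- common endpoint is recovered through injectivity of `index`.
  L-finiteGraph≤lineGraph : L finiteGraph ≤ᴴ lineGraph
  L-finiteGraph≤lineGraph = record
    { map      = proj₁ ∘ matching
    ; map-pres = λ {x} {y} (x≢y , i , i∈x , i∈y) →
        (λ eq → x≢y (Matches-unique (subst (Matches x) eq (proj₂ (matching x))) (proj₂ (matching y)))) ,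
        shared {x} {y} (proj₂ (matching x)) (proj₂ (matching y)) i∈x i∈y
    }
    where
    shared : ∀ {x y e f i} → Matches x e → Matches y f → IsEndpoint {finiteGraph} i x → IsEndpoint {finiteGraph} i y →
             ∃[ v ] (v ∈ e × v ∈ f)
    shared {x} {y} mx my i∈x i∈y with endpoint {x} mx i∈x | endpoint {y} my i∈y
    ... | v , p , v∈e | v′ , p′ , v′∈f with refl ← index-injective (trans p (sym p′)) = v , v∈e , v′∈f

  lineGraph≤L-finiteGraph : lineGraph ≤ᴴ L finiteGraph
  lineGraph≤L-finiteGraph = record
    { map      = proj₁ ∘ matching⁻¹
    ; map-pres = λ {e} {f} (e≢f , v , v∈e , v∈f) →
        (λ eq → e≢f (Joins-unique (proj₂ (matching⁻¹ e)) (subst (λ x → Matches x f) (sym eq) (proj₂ (matching⁻¹ f))))) ,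
        index v , endpoint⁻¹ {proj₁ (matching⁻¹ e)} (proj₂ (matching⁻¹ e)) v∈e ,
        endpoint⁻¹ {proj₁ (matching⁻¹ f)} (proj₂ (matching⁻¹ f)) v∈f
    }

-- Countability

-- Bijective binary numeration, with digit 1 for `false` and digit 2 for `true`, the head of the
-- list being the lowest digit.
encodeList : List Bool → ℕ
encodeList []           = 0
encodeList (false ∷ bs) = 1 + 2 * encodeList bs
encodeList (true  ∷ bs) = 2 + 2 * encodeList bs

-- The number is a self-delimiting prefix: `n` digits 2 followed by a digit 1, after which the list
-- begins.
encodePair : ℕ → List Bool → ℕ
encodePair zero    bs = 1 + 2 * encodeList bs
encodePair (suc n) bs = 2 + 2 * encodePair n bs

double-injective : ∀ {m n} → 2 * m ≡ 2 * n → m ≡ n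
double-injective {m} {n} = *-cancelˡ-≡ m n 2

encodeList-injective : Injective _≡_ _≡_ encodeList
encodeList-injective {[]}         {[]}         _  = refl
encodeList-injective {[]}         {false ∷ _}  ()
encodeList-injective {[]}         {true ∷ _}   ()
encodeList-injective {false ∷ _}  {[]}         ()
encodeList-injective {true ∷ _}   {[]}         ()
encodeList-injective {false ∷ bs} {false ∷ cs} eq = cong (false ∷_) (encodeList-injective (double-injective (suc-injective eq)))
encodeList-injective {true ∷ bs}  {true ∷ cs}  eq =
  cong (true ∷_) (encodeList-injective (double-injective (suc-injective (suc-injective eq))))
encodeList-injective {false ∷ bs} {true ∷ cs}  eq = contradiction (suc-injective eq) (even≢odd (encodeList bs) (encodeList cs))
encodeList-injective {true ∷ bs}  {false ∷ cs} eq = contradiction (sym (suc-injective eq)) (even≢odd (encodeList cs) (encodeList bs))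

encodePair-injective : ∀ {m n bs cs} → encodePair m bs ≡ encodePair n cs → m ≡ n × bs ≡ cs
encodePair-injective {zero} {zero} eq = refl , encodeList-injective (double-injective (suc-injective eq))
encodePair-injective {zero} {suc n} {bs} {cs} eq =
  contradiction (suc-injective eq) (even≢odd (encodeList bs) (encodePair n cs))
encodePair-injective {suc m} {zero} {bs} {cs} eq =
  contradiction (sym (suc-injective eq)) (even≢odd (encodeList cs) (encodePair m bs))
encodePair-injective {suc m} {suc n} eq
  with refl , bs≡cs ← encodePair-injective {m} {n} (double-injective (suc-injective (suc-injective eq))) = refl , bs≡cs

tabulate-injective : ∀ {a} {A : Set a} {n} {f g : Fin n → A} → tabulate f ≡ tabulate g → f ≗ g
tabulate-injective {n = suc n} eq zero    = proj₁ (∷-injective eq)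
tabulate-injective {n = suc n} eq (suc i) = tabulate-injective (proj₂ (∷-injective eq)) i

encodeGraph : FiniteGraph → ℕ
encodeGraph G = encodePair order (tabulate (uncurry adj ∘ remQuot order))
  where open FiniteGraph G

encodeGraph-≡⇒≤ᴴ : ∀ {G H} → encodeGraph G ≡ encodeGraph H → L G ≤ᴴ L H
encodeGraph-≡⇒≤ᴴ {G} {H} eq = uncurry (sameTable G H) (encodePair-injective {FiniteGraph.order G} {FiniteGraph.order H} eq)
  where
  table : (G : FiniteGraph) → List Bool
  table G = tabulate (uncurry (FiniteGraph.adj G) ∘ remQuot (FiniteGraph.order G))
  sameTable : ∀ G H → FiniteGraph.order G ≡ FiniteGraph.order H → table G ≡ table H → L G ≤ᴴ L H
  sameTable G@record{ order = n } H@record{} refl tables = record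
    { map      = λ x → record { lo<hi = Edge.lo<hi x ; adjacent = subst T (adj-≡ _ _) (Edge.adjacent x) }
    ; map-pres = λ (x≢y , share) → (λ eq′ → x≢y (Edge-≡ (cong Edge.lo eq′) (cong Edge.hi eq′))) , share
    }
    where
    adj-≡ : ∀ i j → FiniteGraph.adj G i j ≡ FiniteGraph.adj H i j
    adj-≡ i j = subst (λ ij → uncurry (FiniteGraph.adj G) ij ≡ uncurry (FiniteGraph.adj H) ij) (remQuot-combine {n} {n} i j)
      (tabulate-injective tables (combine i j))

least : ∀ {a} {P : Pred ℕ a} → Decidable P → ∃ P → ∃[ n ] P n × (∀ m → P m → n ≤ m)
least {P = P} P? (n , Pn) = <-rec (λ n → P n → Least) step n Pn
  where
  Least = ∃[ n ] P n × (∀ m → P m → n ≤ m)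
  step : ∀ n → (∀ {m} → m < n → P m → Least) → P n → Least
  step n below Pn = case anyUpTo? P? n of λ where
    (yes (m , m<n , Pm)) → below m<n Pm
    (no ¬below)          → n , Pn , λ m Pm → ≮⇒≥ λ m<n → ¬below (m , m<n , Pm)

module _ (em : ExcludedMiddle 0ℓ) (d : ℕ) where
  open Poset (interval d) using (_≈_; module Eq)

  private
    HasCode : LineGraphBetween d → ℕ → Set
    HasCode G n = ∃[ H ] G ≈ H × encodeGraph (LineGraphBetween.root H) ≡ n

    -- Homomorphically equivalent graphs must receive the same number, so the minimum is taken over
    -- the codes of the whole equivalence class.
    leastCode : ∀ G → ∃[ n ] HasCode G n × (∀ m → HasCode G m → n ≤ m)
    leastCode G = least (λ _ → em) (_ , G , Eq.refl {G} , refl)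

  interval-countable : Countable (interval d)
  interval-countable = record
    { to        = proj₁ ∘ leastCode
    ; cong      = λ {G} {H} G≈H → ≤-antisym (code≤ H G (Eq.sym {G} {H} G≈H)) (code≤ G H G≈H)
    ; injective = λ {G} {H} → same-code {G} {H} (proj₁ (proj₂ (leastCode G))) (proj₁ (proj₂ (leastCode H)))
    }
    where
    code≤ : ∀ G H → G ≈ H → proj₁ (leastCode H) ≤ proj₁ (leastCode G)
    code≤ G H G≈H with _ , (G′ , G≈G′ , code) , _ ← leastCode G =
      proj₂ (proj₂ (leastCode H)) _ (G′ , Eq.trans {H} {G} {G′} (Eq.sym {G} {H} G≈H) G≈G′ , code)
    same-code : ∀ {G H m n} → HasCode G m → HasCode H n → m ≡ n → G ≈ H
    same-code {G} {H} (G′ , G≈G′ , refl) (H′ , H≈H′ , q) eq =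
      Eq.trans {G} {G′} {H} G≈G′ (Eq.trans {G′} {H′} {H} G′≈H′ (Eq.sym {H} {H′} H≈H′))
      where
      G′≈H′ : G′ ≈ H′
      G′≈H′ = record { lhs≤rhs = encodeGraph-≡⇒≤ᴴ (trans eq (sym q)) ; rhs≤lhs = encodeGraph-≡⇒≤ᴴ (trans q (sym eq)) }

-- Decorated cycles

Pentagon : Fin 5 → Fin 5 → Set
Pentagon i j = (suc (toℕ i) % 5 ≡ toℕ j) ⊎ (suc (toℕ j) % 5 ≡ toℕ i)

Pentagon-sym : ∀ {i j} → Pentagon i j → Pentagon j i
Pentagon-sym = swap

Pentagon? : ∀ i j → Dec (Pentagon i j)
Pentagon? i j = (_ ≟ _) ⊎-dec (_ ≟ _)

Pentagon-irrefl : ∀ i → ¬ Pentagon i i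
Pentagon-irrefl = from-yes (all? λ i → ¬? (Pentagon? i i))

Pentagon-triangle-free : ∀ i j k → ¬ (Pentagon i j × Pentagon i k × Pentagon j k)
Pentagon-triangle-free = from-yes (all? λ i → all? λ j → all? λ k → ¬? (Pentagon? i j ×-dec Pentagon? i k ×-dec Pentagon? j k))

open FinitePermutation using (Carrier; next; prev; prev-next; next-≢; next-injective; next^; next^-next)

record _At_ (Label : Set) (X : FinitePermutation) : Set where
  constructor _at_
  field
    label : Label
    cell  : Carrier X

open _At_
infix 5 _at_

distinct₃ : ∀ {a} {A : Set a} (f : Fin 3 → A) → f 0F ≢ f 1F → f 0F ≢ f 2F → f 1F ≢ f 2F → Injective _≡_ _≡_ f
distinct₃ f p q r {0F} {0F} _  = refl
distinct₃ f p q r {0F} {1F} eq = contradiction eq p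
distinct₃ f p q r {0F} {2F} eq = contradiction eq q
distinct₃ f p q r {1F} {0F} eq = contradiction (sym eq) p
distinct₃ f p q r {1F} {1F} _  = refl
distinct₃ f p q r {1F} {2F} eq = contradiction eq r
distinct₃ f p q r {2F} {0F} eq = contradiction (sym eq) q
distinct₃ f p q r {2F} {1F} eq = contradiction (sym eq) r
distinct₃ f p q r {2F} {2F} _  = refl

module Necklace (k : ℕ) where

  d : ℕ
  d = 3 + k

  -- For each κ : Fin 3, left κ and right κ are the sides of a K_{d,d} whose edge left κ 0 - right κ 0 is subdivided
  -- by apex κ, and tail κ is pendant at apex κ. The cycle runs through hub and cap alternately, along link inside a
  -- cell and along bridge from cap to the hub of the next cell. The hub is decorated with tail 0; the cap carries
  -- stem, which leads to a fork decorated with tail 1 and tail 2.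
  data VertexLabel : Set where
    hub cap fork : VertexLabel
    apex         : Fin 3 → VertexLabel
    left right   : Fin 3 → Fin d → VertexLabel

  data EdgeLabel : Set where
    top                : Fin 3 → Fin (2 + k) → EdgeLabel
    rest               : Fin 3 → Fin (2 + k) → Fin d → EdgeLabel
    loopˡ loopʳ tail   : Fin 3 → EdgeLabel
    stem link bridge   : EdgeLabel

  Vtx Edg : FinitePermutation → Set
  Vtx X = VertexLabel At X
  Edg X = EdgeLabel At X

  private variable
    X : FinitePermutation
    κ : Fin 3

  module _ {X : FinitePermutation} where

    private variable
      x y : Carrier X

    infix 4 _∈_
    -- Incidence is an inductive family, so that matching on a common endpoint determines the
    -- possible edges. The equation in `hub-bridge` keeps `next X x` out of the index, where it
    -- would block unification.
    data _∈_ : Vtx X → Edg X → Set where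
      left-top    : ∀ {j} → left κ zero at x ∈ top κ j at x
      right-top   : ∀ {j} → right κ (suc j) at x ∈ top κ j at x
      left-rest   : ∀ {i j} → left κ (suc i) at x ∈ rest κ i j at x
      right-rest  : ∀ {i j} → right κ j at x ∈ rest κ i j at x
      left-loop   : left κ zero at x ∈ loopˡ κ at x
      apex-loopˡ  : apex κ at x ∈ loopˡ κ at x
      right-loop  : right κ zero at x ∈ loopʳ κ at x
      apex-loopʳ  : apex κ at x ∈ loopʳ κ at x
      apex-tail   : apex κ at x ∈ tail κ at x
      hub-tail    : hub at x ∈ tail 0F at x
      fork-tail₁  : fork at x ∈ tail 1F at x
      fork-tail₂  : fork at x ∈ tail 2F at x
      fork-stem   : fork at x ∈ stem at x
      cap-stem    : cap at x ∈ stem at x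
      cap-link    : cap at x ∈ link at x
      hub-link    : hub at x ∈ link at x
      cap-bridge  : cap at x ∈ bridge at x
      hub-bridge  : y ≡ next X x → hub at y ∈ bridge at x

  Λ : FinitePermutation → Graph
  Λ X = record
    { Vertex     = Edg X
    ; Adj        = λ e f → e ≢ f × ∃[ v ] (v ∈ e × v ∈ f)
    ; Adj-sym    = λ (e≢f , v , v∈e , v∈f) → ≢-sym e≢f , v , v∈f , v∈e
    ; Adj-irrefl = λ e≡f (e≢f , _) → e≢f e≡f
    }

  tailFoot : Fin 3 → VertexLabel
  tailFoot 0F = hub
  tailFoot 1F = fork
  tailFoot 2F = fork

  src tgt : Edg X → Vtx X
  src         (top κ j at x)    = left κ zero at x
  src         (rest κ i j at x) = left κ (suc i) at x
  src         (loopˡ κ at x)    = left κ zero at x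
  src         (loopʳ κ at x)    = right κ zero at x
  src         (tail κ at x)     = tailFoot κ at x
  src         (stem at x)       = cap at x
  src         (link at x)       = hub at x
  src {X = X} (bridge at x)     = hub at next X x
  tgt (top κ j at x)    = right κ (suc j) at x
  tgt (rest κ i j at x) = right κ j at x
  tgt (loopˡ κ at x)    = apex κ at x
  tgt (loopʳ κ at x)    = apex κ at x
  tgt (tail κ at x)     = apex κ at x
  tgt (stem at x)       = fork at x
  tgt (link at x)       = cap at x
  tgt (bridge at x)     = cap at x

  src∈ : (e : Edg X) → src e ∈ e
  src∈ (top κ j at x)    = left-top
  src∈ (rest κ i j at x) = left-rest
  src∈ (loopˡ κ at x)    = left-loop
  src∈ (loopʳ κ at x)    = right-loop
  src∈ (tail 0F at x)    = hub-tail
  src∈ (tail 1F at x)    = fork-tail₁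
  src∈ (tail 2F at x)    = fork-tail₂
  src∈ (stem at x)       = cap-stem
  src∈ (link at x)       = hub-link
  src∈ (bridge at x)     = hub-bridge refl

  tgt∈ : (e : Edg X) → tgt e ∈ e
  tgt∈ (top κ j at x)    = right-top
  tgt∈ (rest κ i j at x) = right-rest
  tgt∈ (loopˡ κ at x)    = apex-loopˡ
  tgt∈ (loopʳ κ at x)    = apex-loopʳ
  tgt∈ (tail κ at x)     = apex-tail
  tgt∈ (stem at x)       = fork-stem
  tgt∈ (link at x)       = cap-link
  tgt∈ (bridge at x)     = cap-bridge

  ∈⇒end : ∀ {v} {e : Edg X} → v ∈ e → v ≡ src e ⊎ v ≡ tgt e
  ∈⇒end left-top          = inj₁ refl
  ∈⇒end right-top         = inj₂ refl
  ∈⇒end left-rest         = inj₁ refl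
  ∈⇒end right-rest        = inj₂ refl
  ∈⇒end left-loop         = inj₁ refl
  ∈⇒end apex-loopˡ        = inj₂ refl
  ∈⇒end right-loop        = inj₁ refl
  ∈⇒end apex-loopʳ        = inj₂ refl
  ∈⇒end apex-tail         = inj₂ refl
  ∈⇒end hub-tail          = inj₁ refl
  ∈⇒end fork-tail₁        = inj₁ refl
  ∈⇒end fork-tail₂        = inj₁ refl
  ∈⇒end fork-stem         = inj₂ refl
  ∈⇒end cap-stem          = inj₁ refl
  ∈⇒end cap-link          = inj₂ refl
  ∈⇒end hub-link          = inj₁ refl
  ∈⇒end cap-bridge        = inj₂ refl
  ∈⇒end (hub-bridge refl) = inj₁ refl

  -- A homomorphism to the 5-cycle, which excludes triangles.
  pentagonLabel : VertexLabel → Fin 5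
  pentagonLabel hub               = 1F
  pentagonLabel cap               = 0F
  pentagonLabel fork              = 1F
  pentagonLabel (apex _)          = 0F
  pentagonLabel (left _ zero)     = 1F
  pentagonLabel (left _ (suc _))  = 3F
  pentagonLabel (right _ zero)    = 4F
  pentagonLabel (right _ (suc _)) = 2F

  ρ : Vtx X → Fin 5
  ρ = pentagonLabel ∘ label

  Pentagon-edge : (e : Edg X) → Pentagon (ρ (src e)) (ρ (tgt e))
  Pentagon-edge (top κ j at x)          = inj₁ refl
  Pentagon-edge (rest κ i zero at x)    = inj₁ refl
  Pentagon-edge (rest κ i (suc j) at x) = inj₂ refl
  Pentagon-edge (loopˡ κ at x)          = inj₂ refl
  Pentagon-edge (loopʳ κ at x)          = inj₁ refl
  Pentagon-edge (tail 0F at x)          = inj₂ refl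
  Pentagon-edge (tail 1F at x)          = inj₂ refl
  Pentagon-edge (tail 2F at x)          = inj₂ refl
  Pentagon-edge (stem at x)             = inj₁ refl
  Pentagon-edge (link at x)             = inj₂ refl
  Pentagon-edge (bridge at x)           = inj₂ refl

  src≢tgt : (e : Edg X) → src e ≢ tgt e
  src≢tgt e eq = Pentagon-irrefl (ρ (tgt e)) (subst (λ v → Pentagon (ρ v) (ρ (tgt e))) eq (Pentagon-edge e))

  no-parallel : {e f : Edg X} → src e ≡ src f → tgt e ≡ tgt f → e ≡ f
  no-parallel {e = top κ j at x}    {top _ _ at _}    refl refl = refl
  no-parallel {e = top κ j at x}    {loopˡ _ at _}    refl ()
  no-parallel {e = rest κ i j at x} {rest _ _ _ at _} refl refl = refl
  no-parallel {e = loopˡ κ at x}    {top _ _ at _}    refl ()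
  no-parallel {e = loopˡ κ at x}    {loopˡ _ at _}    refl refl = refl
  no-parallel {e = loopʳ κ at x}    {loopʳ _ at _}    refl refl = refl
  no-parallel {e = loopˡ κ at x}    {tail 0F at _}    ()   _
  no-parallel {e = loopˡ κ at x}    {tail 1F at _}    ()   _
  no-parallel {e = loopˡ κ at x}    {tail 2F at _}    ()   _
  no-parallel {e = loopʳ κ at x}    {tail 0F at _}    ()   _
  no-parallel {e = loopʳ κ at x}    {tail 1F at _}    ()   _
  no-parallel {e = loopʳ κ at x}    {tail 2F at _}    ()   _
  no-parallel {e = tail 0F at x}    {tail 0F at _}    refl refl = refl
  no-parallel {e = tail 1F at x}    {tail 1F at _}    refl refl = refl
  no-parallel {e = tail 2F at x}    {tail 2F at _}    refl refl = refl
  no-parallel {e = stem at x}       {stem at _}       refl refl = refl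
  no-parallel {e = link at x}       {link at _}       refl refl = refl
  -- At a fixed point of `next` the link and the bridge of a cell would join the same hub and cap.
  no-parallel {X} {link at x}       {bridge at _}     eq   refl = contradiction (cong cell eq) (next-≢ X x)
  no-parallel {X} {bridge at x}     {link at _}       eq   refl = contradiction (sym (cong cell eq)) (next-≢ X x)
  no-parallel {e = bridge at x}     {bridge at _}     _    refl = refl

  -- All edges are oriented towards higher rank, which excludes antiparallel pairs.
  rank : VertexLabel → ℕ
  rank hub         = 0
  rank cap         = 1
  rank fork        = 2
  rank (left _ _)  = 1
  rank (right _ _) = 2
  rank (apex _)    = 3

  rank-< : (e : Edg X) → rank (label (src e)) < rank (label (tgt e))
  rank-< (top κ j at x)    = from-yes (1 <? 2)
  rank-< (rest κ i j at x) = from-yes (1 <? 2)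
  rank-< (loopˡ κ at x)    = from-yes (1 <? 3)
  rank-< (loopʳ κ at x)    = from-yes (2 <? 3)
  rank-< (tail 0F at x)    = from-yes (0 <? 3)
  rank-< (tail 1F at x)    = from-yes (2 <? 3)
  rank-< (tail 2F at x)    = from-yes (2 <? 3)
  rank-< (stem at x)       = from-yes (1 <? 2)
  rank-< (link at x)       = from-yes (0 <? 1)
  rank-< (bridge at x)     = from-yes (0 <? 1)

  no-antiparallel : {e f : Edg X} → src e ≡ tgt f → tgt e ≡ src f → ⊥
  no-antiparallel {e = e} {f} p q =
    <-asym (rank-< e) (subst₂ (λ v v′ → rank (label v) < rank (label v′)) (sym q) (sym p) (rank-< f))

  -- Cliques and stars

  module _ {X : FinitePermutation} where

    two-ends : ∀ {v w} {e : Edg X} → v ∈ e → w ∈ e → v ≡ w ⊎ Pentagon (ρ v) (ρ w)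
    two-ends {e = e} v∈e w∈e with ∈⇒end v∈e | ∈⇒end w∈e
    ... | inj₁ refl | inj₁ refl = inj₁ refl
    ... | inj₁ refl | inj₂ refl = inj₂ (Pentagon-edge e)
    ... | inj₂ refl | inj₁ refl = inj₂ (Pentagon-sym {ρ (src e)} (Pentagon-edge e))
    ... | inj₂ refl | inj₂ refl = inj₁ refl

    joins-unique : ∀ {v w} {e f : Edg X} → v ≢ w → v ∈ e → w ∈ e → v ∈ f → w ∈ f → e ≡ f
    joins-unique v≢w v∈e w∈e v∈f w∈f with ∈⇒end v∈e | ∈⇒end w∈e | ∈⇒end v∈f | ∈⇒end w∈f
    ... | inj₁ refl | inj₁ refl | _      | _      = contradiction refl v≢w
    ... | inj₂ refl | inj₂ refl | _      | _      = contradiction refl v≢w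
    ... | _         | _         | inj₁ p | inj₁ q = contradiction (trans p (sym q)) v≢w
    ... | _         | _         | inj₂ p | inj₂ q = contradiction (trans p (sym q)) v≢w
    ... | inj₁ refl | inj₂ refl | inj₁ p | inj₂ q = no-parallel p q
    ... | inj₁ refl | inj₂ refl | inj₂ p | inj₁ q = contradiction q (no-antiparallel p)
    ... | inj₂ refl | inj₁ refl | inj₁ p | inj₂ q = contradiction p (no-antiparallel q)
    ... | inj₂ refl | inj₁ refl | inj₂ p | inj₁ q = no-parallel q p

    -- Otherwise `g` meets `e` and `f` in ends `z` and `t` different from `v`. If these coincide,
    -- then `e` and `f` are parallel; if not, then `v`, `z` and `t` form a triangle, which the
    -- 5-cycle does not admit.
    triangle : ∀ {v} {e f g : Edg X} → e ≢ f → v ∈ e → v ∈ f → Adj (Λ X) g e → Adj (Λ X) g f → v ∈ g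
    triangle {v} e≢f v∈e v∈f (_ , z , z∈g , z∈e) (_ , t , t∈g , t∈f) with two-ends v∈e z∈e | two-ends v∈f t∈f | two-ends z∈g t∈g
    ... | inj₁ refl | _         | _         = z∈g
    ... | inj₂ _    | inj₁ refl | _         = t∈g
    ... | inj₂ vz   | inj₂ vt   | inj₂ zt   = contradiction (vz , vt , zt) (Pentagon-triangle-free (ρ v) (ρ z) (ρ t))
    ... | inj₂ vz   | inj₂ vt   | inj₁ refl =
      contradiction (joins-unique (λ { refl → Pentagon-irrefl _ vz }) v∈e z∈e v∈f t∈f) e≢f

    IsClique : ∀ {n} → (Fin n → Edg X) → Set
    IsClique q = ∀ {i j} → i ≢ j → Adj (Λ X) (q i) (q j)

    clique⇒star : ∀ {n} {q : Fin (2 + n) → Edg X} → IsClique q → ∃[ v ] ∀ i → v ∈ q i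
    clique⇒star {q = q} clique with clique {0F} {1F} (λ ())
    ... | q₀≢q₁ , v , v∈q₀ , v∈q₁ = v , λ where
      zero          → v∈q₀
      (suc zero)    → v∈q₁
      (suc (suc i)) → triangle q₀≢q₁ v∈q₀ v∈q₁ (clique λ ()) (clique λ ())

  -- The corner of the array is loopˡ in the first row and loopʳ in the first column.
  row column : Fin 3 → Fin d → Fin d → EdgeLabel
  row κ zero    zero    = loopˡ κ
  row κ zero    (suc j) = top κ j
  row κ (suc i) j       = rest κ i j
  column κ zero    zero    = loopʳ κ
  column κ (suc i) zero    = rest κ i zero
  column κ zero    (suc j) = top κ j
  column κ (suc i) (suc j) = rest κ i (suc j)

  degree : VertexLabel → ℕ
  degree (left _ _)  = d
  degree (right _ _) = d
  degree _           = 3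

  module _ {X : FinitePermutation} where

    star : (v : Vtx X) → Fin (degree (label v)) → Edg X
    star (hub at x)       0F = tail 0F at x
    star (hub at x)       1F = link at x
    -- A bridge belongs to the cell of its cap, so the one arriving at this hub comes from the
    -- previous cell.
    star (hub at x)       2F = bridge at prev X x
    star (cap at x)       0F = stem at x
    star (cap at x)       1F = link at x
    star (cap at x)       2F = bridge at x
    star (fork at x)      0F = tail 1F at x
    star (fork at x)      1F = tail 2F at x
    star (fork at x)      2F = stem at x
    star (apex κ at x)    0F = loopˡ κ at x
    star (apex κ at x)    1F = loopʳ κ at x
    star (apex κ at x)    2F = tail κ at x
    star (left κ i at x)  j  = row κ i j at x
    star (right κ j at x) i  = column κ i j at x

    ∈⇒star : ∀ {v e} → v ∈ e → ∃[ p ] e ≡ star v p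
    ∈⇒star left-top   = suc _ , refl
    ∈⇒star (right-top {j = j}) = zero , refl
    ∈⇒star left-rest  = _ , refl
    ∈⇒star (right-rest {i = i} {zero})  = suc i , refl
    ∈⇒star (right-rest {i = i} {suc _}) = suc i , refl
    ∈⇒star left-loop  = zero , refl
    ∈⇒star right-loop = zero , refl
    ∈⇒star apex-loopˡ = 0F , refl
    ∈⇒star apex-loopʳ = 1F , refl
    ∈⇒star apex-tail  = 2F , refl
    ∈⇒star hub-tail   = 0F , refl
    ∈⇒star hub-link   = 1F , refl
    ∈⇒star (hub-bridge refl) = 2F , cong (bridge at_) (sym (prev-next X _))
    ∈⇒star fork-tail₁ = 0F , refl
    ∈⇒star fork-tail₂ = 1F , refl
    ∈⇒star fork-stem  = 2F , refl
    ∈⇒star cap-stem   = 0F , refl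
    ∈⇒star cap-link   = 1F , refl
    ∈⇒star cap-bridge = 2F , refl

    row-∈ : ∀ κ i j {x : Carrier X} → _∈_ {X} (left κ i at x) (row κ i j at x)
    row-∈ κ zero    zero    = left-loop
    row-∈ κ zero    (suc j) = left-top
    row-∈ κ (suc i) j       = left-rest

    column-∈ : ∀ κ i j {x : Carrier X} → _∈_ {X} (right κ j at x) (column κ i j at x)
    column-∈ κ zero    zero    = right-loop
    column-∈ κ zero    (suc j) = right-top
    column-∈ κ (suc i) zero    = right-rest
    column-∈ κ (suc i) (suc j) = right-rest

  row-injective : ∀ {κ i j j′} → row κ i j ≡ row κ i j′ → j ≡ j′
  row-injective {i = zero}  {zero}  {zero}  _    = refl
  row-injective {i = zero}  {suc _} {suc _} refl = refl
  row-injective {i = suc _}                 refl = refl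

  column-injective : ∀ {κ i i′ j} → column κ i j ≡ column κ i′ j → i ≡ i′
  column-injective {i = zero}  {zero}  {_}     _    = refl
  column-injective {i = suc _} {suc _} {zero}  refl = refl
  column-injective {i = suc _} {suc _} {suc _} refl = refl
  column-injective {i = suc _} {zero} {zero} ()
  column-injective {i = zero} {suc _} {zero} ()
  column-injective {i = suc _} {zero} {suc _} ()
  column-injective {i = zero} {suc _} {suc _} ()

  -- Weights and colours from Latin squares

  latin : Fin 3 → Fin d → Fin d → Fin d
  latin κ i j = (toℕ κ + toℕ i + toℕ j) mod d

  latin-comm : ∀ κ i j → latin κ i j ≡ latin κ j i
  latin-comm κ i j = cong (_mod d) (begin
    toℕ κ + toℕ i + toℕ j   ≡⟨ +-assoc (toℕ κ) (toℕ i) (toℕ j) ⟩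
    toℕ κ + (toℕ i + toℕ j) ≡⟨ cong (toℕ κ +_) (+-comm (toℕ i) (toℕ j)) ⟩
    toℕ κ + (toℕ j + toℕ i) ≡⟨ +-assoc (toℕ κ) (toℕ j) (toℕ i) ⟨
    toℕ κ + toℕ j + toℕ i   ∎)
    where open ≡-Reasoning

  latin-injectiveʳ : ∀ κ i → Injective _≡_ _≡_ (latin κ i)
  latin-injectiveʳ κ i {j} {j′} eq = +-%-injective (toℕ κ + toℕ i)
    (trans (sym (toℕ-mod (toℕ κ + toℕ i + toℕ j) d)) (trans (cong toℕ eq) (toℕ-mod (toℕ κ + toℕ i + toℕ j′) d)))

  latin-injectiveˡ : ∀ κ j → Injective _≡_ _≡_ (λ i → latin κ i j)
  latin-injectiveˡ κ j {i} {i′} eq =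
    latin-injectiveʳ κ j (trans (latin-comm κ j i) (trans eq (latin-comm κ i′ j)))

  -- For d = 3 all vertices have full degree; the weights are chosen such that each star then weighs 10 = 2 + 3 + 5.
  symbol : ℕ → ℕ
  symbol 0                   = 2
  symbol 1                   = 3
  symbol 2                   = 5
  symbol (suc (suc (suc n))) = 6 + n

  symbol-injective : Injective _≡_ _≡_ symbol
  symbol-injective {0} {0} _ = refl
  symbol-injective {1} {1} _ = refl
  symbol-injective {2} {2} _ = refl
  symbol-injective {0} {2} ()
  symbol-injective {1} {2} ()
  symbol-injective {0} {suc (suc (suc _))} ()
  symbol-injective {1} {suc (suc (suc _))} ()
  symbol-injective {suc (suc (suc m))} {suc (suc (suc n))} refl = refl

  -- The shift in `latin` puts κ in the corner, so the loops weigh 2, 3 and 5 for the three values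
  -- of κ, and `tail κ` completes twice this weight to 10. The tails thus weigh 6, 4 and 0; the stem
  -- gives 4 + 0 + 6 at the fork, and link and bridge give 6 + 1 + 3 at hub and cap.
  labelWeight : EdgeLabel → ℕ
  labelWeight (top κ j)    = symbol (toℕ (latin κ zero (suc j)))
  labelWeight (rest κ i j) = symbol (toℕ (latin κ (suc i) j))
  labelWeight (loopˡ κ)    = symbol (toℕ (latin κ zero zero))
  labelWeight (loopʳ κ)    = symbol (toℕ (latin κ zero zero))
  labelWeight (tail 0F)    = 6
  labelWeight (tail 1F)    = 4
  labelWeight (tail 2F)    = 0
  labelWeight stem         = 6
  labelWeight link         = 1
  labelWeight bridge       = 3

  weight : Edg X → ℕ
  weight = labelWeight ∘ label

  row-weight : ∀ κ i j → labelWeight (row κ i j) ≡ symbol (toℕ (latin κ i j))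
  row-weight κ zero    zero    = refl
  row-weight κ zero    (suc j) = refl
  row-weight κ (suc i) j       = refl

  column-weight : ∀ κ i j → labelWeight (column κ i j) ≡ symbol (toℕ (latin κ i j))
  column-weight κ zero    zero    = refl
  column-weight κ zero    (suc j) = refl
  column-weight κ (suc i) zero    = refl
  column-weight κ (suc i) (suc j) = refl

  starWeight : ℕ
  starWeight = sum {d} (symbol ∘ toℕ)

  Loops : (e f : Edg X) → Set
  Loops {X} e f = ∃[ κ ] ∃[ x ] e ≡ (loopˡ κ at x) × f ≡ (loopʳ κ at x)

  -- A proper edge colouring: the Latin square colours K_{d,d}, and the additional colour `fromℕ d`
  -- goes to one half of each subdivided edge.
  colour : EdgeLabel → Fin (suc d)
  colour (top κ j)    = inject₁ (latin κ zero (suc j))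
  colour (rest κ i j) = inject₁ (latin κ (suc i) j)
  colour (loopˡ κ)    = inject₁ (latin κ zero zero)
  colour (loopʳ κ)    = fromℕ d
  colour (tail 0F)    = 1F
  colour (tail 1F)    = 2F
  colour (tail 2F)    = 0F
  colour stem         = 1F
  colour link         = 0F
  colour bridge       = 2F

  row-colour : ∀ κ i j → colour (row κ i j) ≡ inject₁ (latin κ i j)
  row-colour κ zero    zero    = refl
  row-colour κ zero    (suc j) = refl
  row-colour κ (suc i) j       = refl

  column-colour-injective : ∀ κ i i′ j → colour (column κ i j) ≡ colour (column κ i′ j) → i ≡ i′
  column-colour-injective κ zero    zero     _       _  = refl
  column-colour-injective κ zero    (suc i′) zero    eq = contradiction eq fromℕ≢inject₁
  column-colour-injective κ (suc i) zero     zero    eq = contradiction (sym eq) fromℕ≢inject₁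
  column-colour-injective κ (suc i) (suc i′) zero    eq = latin-injectiveˡ κ zero (inject₁-injective eq)
  column-colour-injective κ zero    (suc i′) (suc j) eq = latin-injectiveˡ κ (suc j) (inject₁-injective eq)
  column-colour-injective κ (suc i) zero     (suc j) eq = latin-injectiveˡ κ (suc j) (inject₁-injective eq)
  column-colour-injective κ (suc i) (suc i′) (suc j) eq = latin-injectiveˡ κ (suc j) (inject₁-injective eq)

  module _ {X : FinitePermutation} where

    star-sum : (v : Vtx X) → degree (label v) ≡ d → sum (weight ∘ star v) ≡ starWeight
    -- Here `refl` forces `k` to be 0, and both sides compute to 10; likewise for the cap, the fork
    -- and the apices.
    star-sum (hub at x)       refl = refl
    star-sum (cap at x)       refl = refl
    star-sum (fork at x)      refl = refl
    star-sum (apex 0F at x)   refl = refl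
    star-sum (apex 1F at x)   refl = refl
    star-sum (apex 2F at x)   refl = refl
    star-sum (left κ i at x)  refl =
      trans (sum-cong-≗ (row-weight κ i)) (sum-injective (symbol ∘ toℕ) (latin-injectiveʳ κ i) refl)
    star-sum (right κ j at x) refl =
      trans (sum-cong-≗ λ i → column-weight κ i j) (sum-injective (symbol ∘ toℕ) (latin-injectiveˡ κ j) refl)

    loop≢tail : ∀ κ → labelWeight (loopˡ κ) ≢ labelWeight (tail κ)
    loop≢tail 0F ()
    loop≢tail 1F ()
    loop≢tail 2F ()

    same-weight : (v : Vtx X) → ∀ p q → weight (star v p) ≡ weight (star v q) →
                  p ≡ q ⊎ Loops (star v p) (star v q) ⊎ Loops (star v q) (star v p)
    same-weight (hub at x)    p  q  eq = inj₁ (distinct₃ (weight ∘ star (hub at x)) (λ ()) (λ ()) (λ ()) eq)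
    same-weight (cap at x)    p  q  eq = inj₁ (distinct₃ (weight ∘ star (cap at x)) (λ ()) (λ ()) (λ ()) eq)
    same-weight (fork at x)   p  q  eq = inj₁ (distinct₃ (weight ∘ star (fork at x)) (λ ()) (λ ()) (λ ()) eq)
    same-weight (apex κ at x) 0F 0F _  = inj₁ refl
    same-weight (apex κ at x) 0F 1F _  = inj₂ (inj₁ (κ , x , refl , refl))
    same-weight (apex κ at x) 0F 2F eq = contradiction eq (loop≢tail κ)
    same-weight (apex κ at x) 1F 0F _  = inj₂ (inj₂ (κ , x , refl , refl))
    same-weight (apex κ at x) 1F 1F _  = inj₁ refl
    same-weight (apex κ at x) 1F 2F eq = contradiction eq (loop≢tail κ)
    same-weight (apex κ at x) 2F 0F eq = contradiction (sym eq) (loop≢tail κ)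
    same-weight (apex κ at x) 2F 1F eq = contradiction (sym eq) (loop≢tail κ)
    same-weight (apex κ at x) 2F 2F _  = inj₁ refl
    same-weight (left κ i at x) p q eq = inj₁ (latin-injectiveʳ κ i (toℕ-injective (symbol-injective
      (trans (sym (row-weight κ i p)) (trans eq (row-weight κ i q))))))
    same-weight (right κ j at x) p q eq = inj₁ (latin-injectiveˡ κ j (toℕ-injective (symbol-injective
      (trans (sym (column-weight κ p j)) (trans eq (column-weight κ q j))))))

    same-colour : (v : Vtx X) → ∀ p q → colour (label (star v p)) ≡ colour (label (star v q)) → p ≡ q
    same-colour (hub at x) p q eq = distinct₃ (colour ∘ label ∘ star (hub at x)) (λ ()) (λ ()) (λ ()) eq
    same-colour (cap at x) p q eq = distinct₃ (colour ∘ label ∘ star (cap at x)) (λ ()) (λ ()) (λ ()) eq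
    same-colour (fork at x) p q eq = distinct₃ (colour ∘ label ∘ star (fork at x)) (λ ()) (λ ()) (λ ()) eq
    same-colour (apex 0F at x) p q eq = distinct₃ (colour ∘ label ∘ star (apex 0F at x)) (λ ()) (λ ()) (λ ()) eq
    same-colour (apex 1F at x) p q eq = distinct₃ (colour ∘ label ∘ star (apex 1F at x)) (λ ()) (λ ()) (λ ()) eq
    same-colour (apex 2F at x) p q eq = distinct₃ (colour ∘ label ∘ star (apex 2F at x)) (λ ()) (λ ()) (λ ()) eq
    same-colour (left κ i at x) p q eq = latin-injectiveʳ κ i (inject₁-injective
      (trans (sym (row-colour κ i p)) (trans eq (row-colour κ i q))))
    same-colour (right κ j at x) p q eq = column-colour-injective κ p q j eq

  -- Weights of cliques and bounds by complete graphs

  module _ {X : FinitePermutation} where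

    degree-≤ : ∀ v → degree v ≤ d
    degree-≤ hub         = m≤m+n 3 k
    degree-≤ cap         = m≤m+n 3 k
    degree-≤ fork        = m≤m+n 3 k
    degree-≤ (apex _)    = m≤m+n 3 k
    degree-≤ (left _ _)  = ≤-refl
    degree-≤ (right _ _) = ≤-refl

    clique-injective : ∀ {n} {q : Fin n → Edg X} → IsClique q → Injective _≡_ _≡_ q
    clique-injective clique {i} {j} eq with i Fin.≟ j
    ... | yes i≡j = i≡j
    ... | no  i≢j = contradiction eq (proj₁ (clique i≢j))

    module _ {n} {q : Fin n → Edg X} (clique : IsClique q) {v} (v∈q : ∀ i → v ∈ q i) where

      position : Fin n → Fin (degree (label v))
      position = proj₁ ∘ ∈⇒star ∘ v∈q

      position-injective : Injective _≡_ _≡_ position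
      position-injective {i} {j} eq = clique-injective clique
        (trans (proj₂ (∈⇒star (v∈q i))) (trans (cong (star v) eq) (sym (proj₂ (∈⇒star (v∈q j))))))

    clique-size : ∀ {n} {q : Fin (2 + n) → Edg X} → IsClique q → 2 + n ≤ d
    clique-size clique with v , v∈q ← clique⇒star clique =
      ≤-trans (injective⇒≤ (position-injective clique v∈q)) (degree-≤ (label v))

    -- The clique lies in a star of at most `d` edges and therefore exhausts it.
    clique-sum : {q : Fin d → Edg X} → IsClique q → sum (weight ∘ q) ≡ starWeight
    clique-sum {q} clique with v , v∈q ← clique⇒star clique = begin
      sum (weight ∘ q)                               ≡⟨ sum-cong-≗ (cong weight ∘ proj₂ ∘ ∈⇒star ∘ v∈q) ⟩
      sum (weight ∘ star v ∘ position clique v∈q)    ≡⟨ sum-injective (weight ∘ star v) (position-injective clique v∈q) (sym degree≡d) ⟩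
      sum (weight ∘ star v)                          ≡⟨ star-sum v degree≡d ⟩
      starWeight                                     ∎
      where
      open ≡-Reasoning
      degree≡d = ≤-antisym (degree-≤ (label v)) (injective⇒≤ (position-injective clique v∈q))

    adjacent-same-weight : {e f : Edg X} → Adj (Λ X) e f → weight e ≡ weight f → Loops e f ⊎ Loops f e
    adjacent-same-weight (e≢f , v , v∈e , v∈f) eq with ∈⇒star v∈e | ∈⇒star v∈f
    ... | p , refl | q , refl with same-weight v p q eq
    ...   | inj₁ refl  = contradiction refl e≢f
    ...   | inj₂ loops = loops

    row-clique : ∀ κ i x → IsClique {X} λ j → row κ i j at x
    row-clique κ i x {j} {j′} j≢j′ =
      j≢j′ ∘ row-injective {κ} {i} ∘ cong label , left κ i at x , row-∈ κ i j , row-∈ κ i j′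

    column-clique : ∀ κ j x → IsClique {X} λ i → column κ i j at x
    column-clique κ j x {i} {i′} i≢i′ =
      i≢i′ ∘ column-injective {κ} {j = j} ∘ cong label , right κ j at x , column-∈ κ i j , column-∈ κ i′ j

    K≤Λ : Carrier X → K d ≤ᴴ Λ X
    K≤Λ x = record { map = λ j → row 0F zero j at x ; map-pres = row-clique 0F zero x }

    K≰Λ : ¬ (K (suc d) ≤ᴴ Λ X)
    K≰Λ φ = 1+n≰n (clique-size {q = _≤ᴴ_.map φ} (_≤ᴴ_.map-pres φ))

    colour-proper : ∀ {v} {e f : Edg X} → v ∈ e → v ∈ f → colour (label e) ≡ colour (label f) → e ≡ f
    colour-proper {v} v∈e v∈f eq with ∈⇒star v∈e | ∈⇒star v∈f
    ... | p , refl | q , refl = cong (star v) (same-colour v p q eq)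

    Λ≤K : Λ X ≤ᴴ K (suc d)
    Λ≤K = record { map = colour ∘ label ; map-pres = λ (e≢f , v , v∈e , v∈f) → e≢f ∘ colour-proper v∈e v∈f }

    -- By `triangle` the edge `g` passes through the apex, where only the tail is left.
    loops⇒tail : ∀ {e f g : Edg X} → Loops e f → Adj (Λ X) g e → Adj (Λ X) g f → ∃[ κ ] ∃[ x ] g ≡ tail κ at x
    loops⇒tail (κ , x , refl , refl) g~e g~f
      with ∈⇒star (triangle (λ ()) apex-loopˡ apex-loopʳ g~e g~f)
    ... | 0F , refl = contradiction refl (proj₁ g~e)
    ... | 1F , refl = contradiction refl (proj₁ g~f)
    ... | 2F , g≡   = κ , x , g≡

  -- Local structure along the cycle

  IsTail : ∀ {Y} → Edg Y → Set
  IsTail e = ∃[ κ ] ∃[ y ] e ≡ tail κ at y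

  module _ {Y : FinitePermutation} where

    cap∉tail : ∀ {y} {e : Edg Y} → IsTail e → ¬ (cap at y ∈ e)
    cap∉tail (_ , _ , refl) ()

    -- Distinct tails meet only at a fork, and the third edge there is the stem.
    adjacent-tails : {e f g : Edg Y} → IsTail e → IsTail f → Adj (Λ Y) e f →
                     Adj (Λ Y) g e → Adj (Λ Y) g f → ∃[ y ] g ≡ stem at y
    adjacent-tails {e} {f} {g} e-tail f-tail (e≢f , _ , v∈e , v∈f) g~e g~f = shared e-tail f-tail v∈e v∈f
      where
      stem-at : ∀ {y} → fork at y ∈ g → tail 1F at y ≢ g → tail 2F at y ≢ g → ∃[ y ] g ≡ stem at y
      stem-at fork-tail₁ ≢₁ _  = contradiction refl ≢₁
      stem-at fork-tail₂ _  ≢₂ = contradiction refl ≢₂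
      stem-at fork-stem  _  _  = _ , refl
      shared : ∀ {v} → IsTail e → IsTail f → v ∈ e → v ∈ f → ∃[ y ] g ≡ stem at y
      shared (_ , _ , refl) (_ , _ , refl) apex-tail  apex-tail  = contradiction refl e≢f
      shared (_ , _ , refl) (_ , _ , refl) hub-tail   hub-tail   = contradiction refl e≢f
      shared (_ , _ , refl) (_ , _ , refl) fork-tail₁ fork-tail₁ = contradiction refl e≢f
      shared (_ , _ , refl) (_ , _ , refl) fork-tail₂ fork-tail₂ = contradiction refl e≢f
      shared (_ , _ , refl) (_ , _ , refl) fork-tail₁ fork-tail₂ =
        stem-at (triangle e≢f fork-tail₁ fork-tail₂ g~e g~f) (≢-sym (proj₁ g~e)) (≢-sym (proj₁ g~f))
      shared (_ , _ , refl) (_ , _ , refl) fork-tail₂ fork-tail₁ =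
        stem-at (triangle e≢f fork-tail₂ fork-tail₁ g~e g~f) (≢-sym (proj₁ g~f)) (≢-sym (proj₁ g~e))

    fork-edge : ∀ {y} {e : Edg Y} → fork at y ∈ e → e ≢ stem at y → IsTail e
    fork-edge fork-tail₁ _  = 1F , _ , refl
    fork-edge fork-tail₂ _  = 2F , _ , refl
    fork-edge fork-stem  e≢ = contradiction refl e≢

    cap-edge : ∀ {y} {e : Edg Y} → cap at y ∈ e → e ≢ stem at y → e ≡ bridge at y ⊎ e ≡ link at y
    cap-edge cap-stem   e≢ = contradiction refl e≢
    cap-edge cap-link   _  = inj₂ refl
    cap-edge cap-bridge _  = inj₁ refl

    module _ {e f t : Edg Y} (e~f : Adj (Λ Y) e f) (t-tail : IsTail t) (t~e : Adj (Λ Y) t e) (t~f : Adj (Λ Y) t f) where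

      -- If e met stem at the fork, it would be a tail, hence so would its neighbour f; but no three tails are pairwise
      -- adjacent.
      at-cap : ∀ {y y′} → Adj (Λ Y) e (stem at y) → Adj (Λ Y) f (stem at y′) → cap at y ∈ e
      at-cap (_   , _ , cap∈e  , cap-stem)  _ = cap∈e
      at-cap (e≢s , _ , fork∈e , fork-stem) (f≢s , _ , fork∈f , fork-stem)
        with y″ , t≡stem ← adjacent-tails (fork-edge fork∈e e≢s) (fork-edge fork∈f f≢s) e~f t~e t~f =
        contradiction (subst (cap at y″ ∈_) (sym t≡stem) cap-stem) (cap∉tail t-tail)
      at-cap (e≢s , _ , fork∈e , fork-stem) (f≢s , _ , cap∈f , cap-stem) =
        contradiction (proj₂ e~f) (disjoint (fork-edge fork∈e e≢s) (cap-edge cap∈f f≢s) fork∈e)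
        where
        disjoint : ∀ {y y′} → IsTail e → f ≡ bridge at y′ ⊎ f ≡ link at y′ → fork at y ∈ e → ¬ (∃[ v ] (v ∈ e × v ∈ f))
        disjoint (_ , _ , refl) (inj₁ refl) fork-tail₁ (_ , fork-tail₁ , ())
        disjoint (_ , _ , refl) (inj₁ refl) fork-tail₁ (_ , apex-tail , ())
        disjoint (_ , _ , refl) (inj₁ refl) fork-tail₂ (_ , fork-tail₂ , ())
        disjoint (_ , _ , refl) (inj₁ refl) fork-tail₂ (_ , apex-tail , ())
        disjoint (_ , _ , refl) (inj₂ refl) fork-tail₁ (_ , fork-tail₁ , ())
        disjoint (_ , _ , refl) (inj₂ refl) fork-tail₁ (_ , apex-tail , ())
        disjoint (_ , _ , refl) (inj₂ refl) fork-tail₂ (_ , fork-tail₂ , ())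
        disjoint (_ , _ , refl) (inj₂ refl) fork-tail₂ (_ , apex-tail , ())

      -- This forbids folding: two edges with a common neighbour among the tails cannot meet at a
      -- cap, since `triangle` would put the tail there too. Applied to images, it keeps hubs from
      -- being sent to caps.
      no-cap : ∀ {y} → cap at y ∈ e → ¬ (cap at y ∈ f)
      no-cap cap∈e cap∈f = cap∉tail t-tail (triangle (proj₁ e~f) cap∈e cap∈f t~e t~f)

      shared-hub : ∀ {y} → e ≡ bridge at y ⊎ e ≡ link at y → ∃[ z ] (hub at z ∈ e × hub at z ∈ f)
      shared-hub e≡ = shared e≡ (proj₂ e~f)
        where
        shared : ∀ {y} → e ≡ bridge at y ⊎ e ≡ link at y →
                 ∃[ v ] (v ∈ e × v ∈ f) → ∃[ z ] (hub at z ∈ e × hub at z ∈ f)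
        shared (inj₁ refl) (_ , cap-bridge             , cap∈f) = contradiction cap∈f (no-cap cap-bridge)
        shared (inj₂ refl) (_ , cap-link               , cap∈f) = contradiction cap∈f (no-cap cap-link)
        shared (inj₁ refl) (_ , hub∈e@(hub-bridge _)   , hub∈f) = _ , hub∈e , hub∈f
        shared (inj₂ refl) (_ , hub-link               , hub∈f) = _ , hub-link , hub∈f

      -- Two bridges at one hub coincide because `next` is injective, so a walk arriving by a bridge
      -- leaves along the link of the following cell.
      bridge-step : ∀ {y y′} → e ≡ bridge at y → f ≡ bridge at y′ ⊎ f ≡ link at y′ → f ≡ link at y′ × y′ ≡ next Y y
      bridge-step refl f≡ with shared-hub (inj₁ refl) | f≡
      ... | _ , hub-bridge p , hub-bridge q | inj₁ refl =
        contradiction (cong (bridge at_) (next-injective Y (trans (sym p) q))) (proj₁ e~f)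
      ... | _ , hub-bridge p , hub-link     | inj₂ refl = refl , p

      link-step : ∀ {y y′} → e ≡ link at y → f ≡ bridge at y′ ⊎ f ≡ link at y′ → f ≡ bridge at y′ × y ≡ next Y y′
      link-step refl f≡ with shared-hub (inj₂ refl) | f≡
      ... | _ , hub-link , hub-bridge q | inj₁ refl = refl , q
      ... | _ , hub-link , hub-link     | inj₂ refl = contradiction refl (proj₁ e~f)

  -- Homomorphisms between decorated cycles

  module _ {X Y : FinitePermutation} (φ : Λ X ≤ᴴ Λ Y) where
    open _≤ᴴ_ φ using (map; map-pres)

    image : EdgeLabel → Carrier X → Edg Y
    image l x = map (l at x)

    -- Every row and every column is a `d`-clique, so its image weighs `starWeight`. The two arrays
    -- of images agree outside the corner, where they hold the images of the two loops.
    loop-weights : ∀ κ x → weight (image (loopˡ κ) x) ≡ weight (image (loopʳ κ) x)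
    loop-weights κ x = corner-≡
      (λ i j → weight (image (row κ i j) x)) (λ i j → weight (image (column κ i j) x))
      (λ { zero _ → refl ; (suc _) _ → refl })
      (λ i → refl)
      (λ i → clique-sum (map-pres ∘ row-clique κ i x))
      (λ j → clique-sum (map-pres ∘ column-clique κ j x))

    image-~ : ∀ {l l′ x x′ v} → (l at x) ≢ (l′ at x′) → v ∈ l at x → v ∈ l′ at x′ → Adj (Λ Y) (image l x) (image l′ x′)
    image-~ e≢f v∈e v∈f = map-pres (e≢f , _ , v∈e , v∈f)

    -- The images of the two loops are adjacent and equally heavy, hence again the loops at some
    -- apex, possibly exchanged; the image of the tail is adjacent to both.
    tail-image : ∀ κ x → IsTail (image (tail κ) x)
    tail-image κ x = [ (λ loops → loops⇒tail loops ~loopˡ ~loopʳ) , (λ loops → loops⇒tail loops ~loopʳ ~loopˡ) ]′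
      (adjacent-same-weight (image-~ (λ ()) apex-loopˡ apex-loopʳ) (loop-weights κ x))
      where
      ~loopˡ = image-~ (λ ()) apex-tail apex-loopˡ
      ~loopʳ = image-~ (λ ()) apex-tail apex-loopʳ

    opaque
      stem-image : ∀ x → ∃[ y ] image stem x ≡ stem at y
      stem-image x = adjacent-tails (tail-image 1F x) (tail-image 2F x) (image-~ (λ ()) fork-tail₁ fork-tail₂)
        (image-~ (λ ()) fork-stem fork-tail₁) (image-~ (λ ()) fork-stem fork-tail₂)

    -- Each cell has exactly one stem, and stems go to stems, so the stem locates the image of the
    -- cell.
    cellMap : Carrier X → Carrier Y
    cellMap = proj₁ ∘ stem-image

    ~stem : ∀ {l x} → l ≢ stem → cap at x ∈ l at x → Adj (Λ Y) (image l x) (stem at cellMap x)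
    ~stem {l} {x} l≢stem cap∈ = subst (Adj (Λ Y) (image l x)) (proj₂ (stem-image x)) (image-~ (l≢stem ∘ cong label) cap∈ cap-stem)

    link~stem : ∀ x → Adj (Λ Y) (image link x) (stem at cellMap x)
    link~stem x = ~stem (λ ()) cap-link

    bridge~stem : ∀ x → Adj (Λ Y) (image bridge x) (stem at cellMap x)
    bridge~stem x = ~stem (λ ()) cap-bridge

    bridge~link : ∀ x → Adj (Λ Y) (image bridge x) (image link (next X x))
    bridge~link x = image-~ (λ ()) (hub-bridge refl) hub-link

    tail~bridge : ∀ x → Adj (Λ Y) (image (tail 0F) (next X x)) (image bridge x)
    tail~bridge x = image-~ (λ ()) hub-tail (hub-bridge refl)

    tail~link : ∀ x → Adj (Λ Y) (image (tail 0F) x) (image link x)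
    tail~link x = image-~ (λ ()) hub-tail hub-link

    cap∈bridge : ∀ x → cap at cellMap x ∈ image bridge x
    -- The bridge ends at the hub of the next cell, where the link and `tail 0F` of that cell
    -- complete the star.
    cap∈bridge x = at-cap (bridge~link x) (tail-image 0F (next X x)) (tail~bridge x) (tail~link (next X x))
      (bridge~stem x) (link~stem (next X x))

    bridge~link-cell : ∀ x → Adj (Λ Y) (image bridge x) (image link x)
    bridge~link-cell x = image-~ (λ ()) cap-bridge cap-link

    cap∈link : ∀ x → cap at cellMap x ∈ image link x
    cap∈link x = triangle (proj₁ (bridge~stem x)) (cap∈bridge x) cap-stem (Adj-sym (Λ Y) (bridge~link-cell x)) (link~stem x)

    bridge-image : ∀ x → image bridge x ≡ bridge at cellMap x ⊎ image bridge x ≡ link at cellMap x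
    bridge-image x = cap-edge (cap∈bridge x) (proj₁ (bridge~stem x))

    link-image : ∀ x → image link x ≡ bridge at cellMap x ⊎ image link x ≡ link at cellMap x
    link-image x = cap-edge (cap∈link x) (proj₁ (link~stem x))

    -- Reflecting a decorated cycle exchanges links and bridges, so a homomorphism may run in either
    -- direction; the direction persists from each cell to the next.
    Forward Backward : Carrier X → Set
    Forward  x = image bridge x ≡ bridge at cellMap x
    Backward x = image bridge x ≡ link at cellMap x

    forward : ∀ {x} → image link x ≡ link at cellMap x → Forward x
    forward {x} link≡ =
      [ id , (λ bridge≡ → contradiction (trans bridge≡ (sym link≡)) (proj₁ (bridge~link-cell x))) ]′ (bridge-image x)

    backward : ∀ {x} → image link x ≡ bridge at cellMap x → Backward x
    backward {x} link≡ =
      [ (λ bridge≡ → contradiction (trans bridge≡ (sym link≡)) (proj₁ (bridge~link-cell x))) , id ]′ (bridge-image x)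

    forward-next : ∀ {x} → Forward x → Forward (next X x) × cellMap (next X x) ≡ next Y (cellMap x)
    forward-next {x} fwd = Product.map₁ forward
      (bridge-step (bridge~link x) (tail-image 0F (next X x)) (tail~bridge x) (tail~link (next X x)) fwd (link-image (next X x)))

    backward-next : ∀ {x} → Backward x → Backward (next X x) × cellMap x ≡ next Y (cellMap (next X x))
    backward-next {x} bwd = Product.map₁ backward
      (link-step (bridge~link x) (tail-image 0F (next X x)) (tail~bridge x) (tail~link (next X x)) bwd (link-image (next X x)))

    forward-next^ : ∀ n {x} → Forward x → Forward (next^ X n x) × cellMap (next^ X n x) ≡ next^ Y n (cellMap x)
    forward-next^ zero    fwd = fwd , refl
    forward-next^ (suc n) fwd = let fwdₙ , eq = forward-next^ n fwd in
      Product.map₂ (λ eq′ → trans eq′ (cong (next Y) eq)) (forward-next fwdₙ)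

    backward-next^ : ∀ n {x} → Backward x → Backward (next^ X n x) × cellMap x ≡ next^ Y n (cellMap (next^ X n x))
    backward-next^ zero    bwd = bwd , refl
    backward-next^ (suc n) bwd = let bwdₙ , eq = backward-next^ n bwd in
      Product.map₂ (λ eq′ → trans eq (trans (cong (next^ Y n) eq′) (next^-next Y n _))) (backward-next bwdₙ)

    -- The direction is constant along the orbit of `x`, so `n` steps in `X` become `n` steps in
    -- `Y`, forwards or backwards. Once they lead back to `x`, both cases give the same equation.
    cellMap-periodic : ∀ n {x} → next^ X n x ≡ x → next^ Y n (cellMap x) ≡ cellMap x
    cellMap-periodic n {x} fixed =
      [ (λ fwd → trans (sym (proj₂ (forward-next^ n fwd))) (cong cellMap fixed))
      , (λ bwd → sym (trans (proj₂ (backward-next^ n bwd)) (cong (next^ Y n ∘ cellMap) fixed)))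
      ]′ (bridge-image x)

  -- Homomorphisms from equivariant maps

  module _ {X Y : FinitePermutation} (f : Carrier X → Carrier Y) (f-next : ∀ x → f (next X x) ≡ next Y (f x)) where

    mapCells : ∀ {Label} → Label At X → Label At Y
    mapCells (l at x) = l at f x

    mapCells-∈ : ∀ {v e} → v ∈ e → mapCells v ∈ mapCells e
    mapCells-∈ left-top          = left-top
    mapCells-∈ right-top         = right-top
    mapCells-∈ left-rest         = left-rest
    mapCells-∈ right-rest        = right-rest
    mapCells-∈ left-loop         = left-loop
    mapCells-∈ apex-loopˡ        = apex-loopˡ
    mapCells-∈ right-loop        = right-loop
    mapCells-∈ apex-loopʳ        = apex-loopʳ
    mapCells-∈ apex-tail         = apex-tail
    mapCells-∈ hub-tail          = hub-tail
    mapCells-∈ fork-tail₁        = fork-tail₁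
    mapCells-∈ fork-tail₂        = fork-tail₂
    mapCells-∈ fork-stem         = fork-stem
    mapCells-∈ cap-stem          = cap-stem
    mapCells-∈ cap-link          = cap-link
    mapCells-∈ hub-link          = hub-link
    mapCells-∈ cap-bridge        = cap-bridge
    mapCells-∈ (hub-bridge refl) = hub-bridge (f-next _)

    equivariant⇒≤ᴴ : Λ X ≤ᴴ Λ Y
    equivariant⇒≤ᴴ = record
      { map      = mapCells
      ; map-pres = λ (e≢g , v , v∈e , v∈g) →
          -- Labels and hence colours are preserved, and adjacent edges differ in colour, so their
          -- images are distinct even if `f` merges cells.
          e≢g ∘ colour-proper v∈e v∈g ∘ cong (colour ∘ label) , mapCells v , mapCells-∈ v∈e , mapCells-∈ v∈g
      }

  -- Decorated cycles as finite graphs in the interval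

  private
    labelCode : VertexLabel → Fin 6 × Fin 3 × Fin d
    labelCode hub         = 0F , 0F , 0F
    labelCode cap         = 1F , 0F , 0F
    labelCode fork        = 2F , 0F , 0F
    labelCode (apex κ)    = 3F , κ  , 0F
    labelCode (left κ i)  = 4F , κ  , i
    labelCode (right κ j) = 5F , κ  , j

    labelCode-injective : Injective _≡_ _≡_ labelCode
    labelCode-injective {hub}       {hub}       _    = refl
    labelCode-injective {cap}       {cap}       _    = refl
    labelCode-injective {fork}      {fork}      _    = refl
    labelCode-injective {apex _}    {apex _}    refl = refl
    labelCode-injective {left _ _}  {left _ _}  refl = refl
    labelCode-injective {right _ _} {right _ _} refl = refl

    combine³ : ∀ {a b c} → Fin a × Fin b × Fin c → Fin (a * (b * c))
    combine³ (i , j , l) = combine i (combine j l)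

    combine³-injective : ∀ {a b c} → Injective _≡_ _≡_ (combine³ {a} {b} {c})
    combine³-injective {x = i , j , l} {i′ , j′ , l′} eq
      with refl , eq′ ← combine-injective i (combine j l) i′ (combine j′ l′) eq
      with refl , refl ← combine-injective j l j′ l′ eq′ = refl

  necklaceSystem : FinitePermutation → EdgeSystem
  necklaceSystem X = record
    { Vert            = Vtx X
    ; Edg             = Edg X
    ; src             = src
    ; tgt             = tgt
    ; src≢tgt         = src≢tgt
    ; no-parallel     = no-parallel
    ; no-antiparallel = no-antiparallel
    ; order           = 6 * (3 * d) * size X
    ; index           = λ v → combine (combine³ (labelCode (label v))) (index X (cell v))
    ; index-injective = λ {v} {w} eq →
        let eqˡ , eqʳ = combine-injective _ (index X (cell v)) _ (index X (cell w)) eq in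
        cong₂ _at_ (labelCode-injective (combine³-injective eqˡ)) (index-injective X eqʳ)
    }
    where open FinitePermutation using (size; index; index-injective)

  module _ (em : ExcludedMiddle 0ℓ) (X : FinitePermutation) where
    open EdgeSystem (necklaceSystem X) using (lineGraph)

    necklaceGraph : FiniteGraph
    necklaceGraph = finiteGraph (necklaceSystem X) em

    private
      Λ≤lineGraph : Λ X ≤ᴴ lineGraph
      Λ≤lineGraph = record { map = id ; map-pres = λ (e≢f , v , v∈e , v∈f) → e≢f , v , ∈⇒end v∈e , ∈⇒end v∈f }

      end⇒∈ : ∀ {v} {e : Edg X} → v ≡ src e ⊎ v ≡ tgt e → v ∈ e
      end⇒∈ {e = e} (inj₁ refl) = src∈ e
      end⇒∈ {e = e} (inj₂ refl) = tgt∈ e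

      lineGraph≤Λ : lineGraph ≤ᴴ Λ X
      lineGraph≤Λ = record { map = id ; map-pres = λ (e≢f , v , v∈e , v∈f) → e≢f , v , end⇒∈ v∈e , end⇒∈ v∈f }

    L≤Λ : L necklaceGraph ≤ᴴ Λ X
    L≤Λ = ≤ᴴ-trans (L-finiteGraph≤lineGraph (necklaceSystem X) em) lineGraph≤Λ

    Λ≤L : Λ X ≤ᴴ L necklaceGraph
    Λ≤L = ≤ᴴ-trans Λ≤lineGraph (lineGraph≤L-finiteGraph (necklaceSystem X) em)

    -- The cell `x` supplies a copy of K_{d,d} and with it the lower bound `K d`.
    necklace : Carrier X → LineGraphBetween d
    necklace x = record
      { root  = necklaceGraph
      ; lower = ≤ᴴ-trans (K≤Λ x) Λ≤L
      ; upper = ≤ᴴ-trans L≤Λ Λ≤K , λ K≤L → K≰Λ {X} (≤ᴴ-trans K≤L L≤Λ)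
      }

-- Universality

module _ {ℓ} {R : Rel ℕ ℓ} (R? : Binary.Decidable R) (R-refl : Reflexive R) (R-trans : Transitive R) where

  private
    number : ℕ → ℕ
    -- The bound `suc n` admits the index `n`, so by reflexivity of `R` the factor `euclid n`
    -- occurs.
    number n = euclidProductOver (R? n) (suc n)

    number≥2 : ∀ n → 2 ≤ number n
    number≥2 n = ≤-trans (s≤s (euclidProduct≥1 n)) (∣⇒≤ (euclid∣euclidProductOver (R? n) ≤-refl R-refl))
      where instance _ = >-nonZero (euclidProductOver≥1 (R? n) (suc n))

    number-∣ : ∀ {m n} → m ≤ n → R n m → number m ∣ number n
    number-∣ m≤n Rnm = euclidProductOver-∣ (R? _) (R? _) (R-trans Rnm) (s≤s m≤n)

    -- The factor `euclid m` of `number m` divides `number n`, and by coprimality this happens only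
    -- for indices selected by `R n`.
    ∣-number : ∀ {m n} → number m ∣ number n → R n m
    ∣-number {m} {n} m∣n = euclid∣euclidProductOver⇒P (R? n) (suc n) (∣-trans (euclid∣euclidProductOver (R? m) ≤-refl R-refl) m∣n)

    -- Indices that are not below n stand for n itself, which only duplicates a cycle.
    below : ∀ n → Fin (suc n) → ℕ
    below n j = if does (R? (toℕ j) n) then toℕ j else n

    below-R : ∀ n j → R (below n j) n
    below-R n j with R? (toℕ j) n
    ... | yes r = r
    ... | no  _ = R-refl

    below-surjective : ∀ {m n} → m ≤ n → R m n → ∃[ j ] below n j ≡ m
    below-surjective {m} {n} m≤n Rmn = fromℕ< (s≤s m≤n) , lemma
      where
      lemma : below n (fromℕ< (s≤s m≤n)) ≡ m
      lemma rewrite Fin.toℕ-fromℕ< (s≤s m≤n) with R? m n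
      ... | yes _   = refl
      ... | no ¬Rmn = contradiction Rmn ¬Rmn

    module C n = Cycles (number ∘ below n) (number≥2 ∘ below n)

    some-∣ : ∀ {m n} → R m n → ∀ i → ∃[ j ] number (below n j) ∣ number (below m i)
    some-∣ {m} {n} Rmn i with ≤-total (below m i) n
    ... | inj₁ i≤n with j , eq ← below-surjective i≤n (R-trans (below-R m i) Rmn) = j , ∣-reflexive (cong number eq)
    ... | inj₂ n≤i with j , eq ← below-surjective {n} {n} ≤-refl R-refl =
      j , subst (λ t → number t ∣ number (below m i)) (sym eq) (number-∣ n≤i (R-trans (below-R m i) Rmn))

  system : ℕ → FinitePermutation
  system n = C.cycles n

  equivariant : ∀ {m n} → R m n → ∃ λ (f : Carrier (system m) → Carrier (system n)) →
                ∀ x → f (next (system m) x) ≡ next (system n) (f x)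
  equivariant {m} {n} Rmn = f , λ (i , r) → cong (proj₁ (some-∣ Rmn i) ,_) (rotateBy-mod (proj₂ (some-∣ Rmn i)) 1 r)
    where
    open C m using () renaming (length-nonZero to nonZero₁)
    open C n using () renaming (length-nonZero to nonZero₂)
    f : Carrier (system m) → Carrier (system n)
    f (i , r) = proj₁ (some-∣ Rmn i) , toℕ r mod number (below n (proj₁ (some-∣ Rmn i)))

  base : ∀ n → Carrier (system n)
  base n = proj₁ (below-surjective {n} ≤-refl R-refl) , 0 mod _
    where open C n using (length-nonZero)

  -- The cycle of length `number m` in the family of `m` is sent into a cycle of length `number j`
  -- with `R j n`. Periodicity makes `number j` divide `number m`, so `R m j`, and transitivity
  -- concludes.
  periodic⇒R : ∀ {m n} (g : Carrier (system m) → Carrier (system n)) →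
               (∀ t {x} → next^ (system m) t x ≡ x → next^ (system n) t (g x) ≡ g x) → R m n
  periodic⇒R {m} {n} g periodic =
    R-trans (∣-number (subst (number (below n (proj₁ y)) ∣_) (cong number (proj₂ (below-surjective {m} ≤-refl R-refl)))
      (C.next^-fixed⇒∣ n _ y (periodic (number (below m (proj₁ (base m)))) (C.next^-length m (base m)))))) (below-R n (proj₁ y))
    where y = g (base m)

-- Embedding a countable order

module _ {c ℓ₁ ℓ₂} (em : ExcludedMiddle (c ⊔ ℓ₁ ⊔ ℓ₂)) (P : Poset c ℓ₁ ℓ₂) (countable : Countable P) where
  private module P = Poset P
  open Injection countable using (to; injective)

  -- The order of `P` carried over to ℕ along `to`; the first alternative makes it reflexive at
  -- numbers outside the image of `to` as well.
  IndexOrder : Rel ℕ (c ⊔ ℓ₂)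
  IndexOrder m n = m ≡ n ⊎ ∃[ a ] ∃[ b ] to a ≡ m × to b ≡ n × a P.≤ b

  IndexOrder? : Binary.Decidable IndexOrder
  IndexOrder? m n = lower-excludedMiddle ℓ₁ em

  IndexOrder-trans : Transitive IndexOrder
  IndexOrder-trans (inj₁ refl) q = q
  IndexOrder-trans p@(inj₂ _) (inj₁ refl) = p
  IndexOrder-trans (inj₂ (a , b , refl , b≡ , a≤b)) (inj₂ (b′ , c , b′≡ , refl , b′≤c)) =
    inj₂ (a , c , refl , refl , P.trans a≤b (P.trans (P.reflexive (injective (trans b≡ (sym b′≡)))) b′≤c))

  IndexOrder-to : ∀ {a b} → a P.≤ b ⇔ IndexOrder (to a) (to b)
  IndexOrder-to {a} {b} = mk⇔ (λ a≤b → inj₂ (a , b , refl , refl , a≤b)) λ where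
    (inj₁ eq) → P.reflexive (injective eq)
    (inj₂ (a′ , b′ , a′≡ , b′≡ , a′≤b′)) →
      P.trans (P.reflexive (injective (sym a′≡))) (P.trans a′≤b′ (P.reflexive (injective b′≡)))

  module _ (k : ℕ) where
    open Necklace k

    em₀ : ExcludedMiddle 0ℓ
    em₀ = lower-excludedMiddle (c ⊔ ℓ₁ ⊔ ℓ₂) em

    cells : P.Carrier → FinitePermutation
    cells a = system IndexOrder? (inj₁ refl) IndexOrder-trans (to a)

    embedding : P.Carrier → LineGraphBetween d
    embedding a = necklace em₀ (cells a) (base IndexOrder? (inj₁ refl) IndexOrder-trans (to a))

    embeds : Embeds P (interval d)
    embeds = embedding , λ a b → mk⇔
      (λ a≤b → let f , f-next = equivariant IndexOrder? (inj₁ refl) IndexOrder-trans (Equivalence.to IndexOrder-to a≤b) in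
        ≤ᴴ-trans (L≤Λ em₀ (cells a)) (≤ᴴ-trans (equivariant⇒≤ᴴ f f-next) (Λ≤L em₀ (cells b))))
      (λ φ → let ψ = ≤ᴴ-trans (Λ≤L em₀ (cells a)) (≤ᴴ-trans φ (L≤Λ em₀ (cells b))) in
        Equivalence.from IndexOrder-to (periodic⇒R IndexOrder? (inj₁ refl) IndexOrder-trans (cellMap ψ) (cellMap-periodic ψ)))

theorem5p8p3 : ∀ {c ℓ₁ ℓ₂} → ExcludedMiddle (c ⊔ ℓ₁ ⊔ ℓ₂) →
    (d : ℕ) → 3 ≤ d → Universal c ℓ₁ ℓ₂ (interval d)
theorem5p8p3 {c} {ℓ₁} {ℓ₂} em .(3 + k) (s≤s (s≤s (s≤s (z≤n {k})))) =
  interval-countable (lower-excludedMiddle (c ⊔ ℓ₁ ⊔ ℓ₂) em) (3 + k) , λ P countable → embeds em P countable k
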